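{- Let $d\ge 2$ be an integer and $p$ an odd prime. For $n\ge0$ let $\alpha_n=\frac{(1/2)_n}{n!}$, where $(x)_n=x(x+1)\cdots(x+n-1)$ (with $(x)_0=1$), and for every integer $s\ge0$ let $$F_{p^s}(z)=\sum_{n=0}^{p^s-1}\alpha_n^d z^n$$ (so $F_1(z)=1$). Let $\epsilon_p=(-1)^{d(p-1)/2}$ and suppose that $F_p(\epsilon_p)$ is a $p$-adic unit. Then $F_{p^s}(\epsilon_p)$ is a $p$-adic unit for every $s\ge 1$, the limit $$f(\epsilon_p)=\lim_{s\to\infty}\frac{F_{p^s}(\epsilon_p)}{F_{p^{s-1}}(\epsilon_p)}$$ exists in $\mathbb{Z}_p$, and $$F_p(\epsilon_p)\equiv f(\epsilon_p)\pmod{p^2}.$$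
   Context: The existence of the limit is a result of Dwork (for any $p$-adic unit $z_0$ with $F_p(z_0)$ a $p$-adic unit, the $F_{p^s}(z_0)$ are $p$-adic units and $F_{p^{s+1}}(z_0)/F_{p^s}(z_0)\equiv F_{p^s}(z_0)/F_{p^{s-1}}(z_0)\pmod{p^s}$ for all $s\ge1$); it is included only to define $f(\epsilon_p)$. Congruences are in $\mathbb{Z}_p$ (the coefficients $\alpha_n$ are $p$-integral rationals). -}

module Defs where

import Algebra.Definitions.RawSemiring
open import Data.Fin.Base using (toℕ)
open import Data.Integer.Base as ℤ using (ℤ; +_)
import Data.Integer.Divisibility as ℤ
open import Data.Nat.Base as ℕ using (ℕ; zero; suc; _!)
import Data.Nat.Divisibility as ℕ
import Data.Nat.DivMod as ℕ
open import Data.Nat.Properties using (_!≢0)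
open import Data.Product.Base using (_×_; _,_; ∃-syntax)
open import Data.Rational.Base
open import Data.Rational.Properties using (*-identityˡ)
open import Relation.Binary.PropositionalEquality.Core using (_≡_; refl; cong; trans; sym; subst)
open import Relation.Nullary.Negation.Core using (¬_)

open Algebra.Definitions.RawSemiring +-*-rawSemiring using (sum; product; _^_) public

ℤ→ℚ : ℤ → ℚ
ℤ→ℚ m = m / 1

ℕ→ℚ : ℕ → ℚ
ℕ→ℚ n = ℤ→ℚ (+ n)

pochhammer : ℚ → ℕ → ℚ
pochhammer x n = product {n} λ i → x + ℕ→ℚ (toℕ i)

α : ℕ → ℚ
α n = pochhammer ½ n * (+ 1 / (n !)) {{n !≢0}}

-- The sum has N terms, so N = p ^ s gives F_{p^s}.
F : (d N : ℕ) → ℚ → ℚ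
F d N z = sum {N} λ n → α (toℕ n) ^ d * z ^ toℕ n

-- The division by 2 is exact for odd p.
ε : (d p : ℕ) → ℚ
ε d p = (- 1ℚ) ^ (d ℕ.* ((p ℕ.∸ 1) ℕ./ 2))

-- Elements of ℚ are in lowest terms, so the divisibility conditions in the next
-- two definitions describe the p-adic valuation (p prime).
IsPIntegral : ℕ → ℚ → Set
IsPIntegral p q = ¬ (p ℕ.∣ ↧ₙ q)

IsPAdicUnit : ℕ → ℚ → Set
IsPAdicUnit p q = ¬ (p ℕ.∣ ℤ.∣ ↥ q ∣) × ¬ (p ℕ.∣ ↧ₙ q)

-- The p-adic integers as the inverse limit of the rings ℤ/pᵏ: the integer
-- residue k represents the class modulo pᵏ, and two elements are equal in ℤₚ
-- when their k-th residues agree modulo pᵏ for all k.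
record ℤₚ (p : ℕ) : Set where
  field
    residue  : ℕ → ℤ
    coherent : ∀ k → (+ (p ℕ.^ k)) ℤ.∣ (residue (suc k) ℤ.- residue k)

open ℤₚ public

-- q ≡ x (mod pᵏ) in ℤₚ, for q rational.  As x ≡ residue x k (mod pᵏ) and
-- pᵏℤₚ ∩ ℚ = pᵏℤ₍ₚ₎, this says q - residue x k ∈ pᵏℤ₍ₚ₎; in particular q is
-- p-integral.
_≡_modPow_ : ∀ {p} → ℚ → ℤₚ p → ℕ → Set
_≡_modPow_ {p} q x k =
  ∃[ r ] IsPIntegral p r × (q - ℤ→ℚ (residue x k) ≡ ℕ→ℚ (p ℕ.^ k) * r)

_ConvergesTo_ : ∀ {p} → (ℕ → ℚ) → ℤₚ p → Set
u ConvergesTo x = ∀ k → ∃[ S ] (∀ s → S ℕ.≤ s → u s ≡ x modPow k)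

AllUnits : (d p : ℕ) → ℚ → Set
AllUnits d p z = ∀ s → 1 ℕ.≤ s → IsPAdicUnit p (F d (p ℕ.^ s) z)

isPAdicUnit⇒nonZero : ∀ p q → IsPAdicUnit p q → NonZero q
isPAdicUnit⇒nonZero p q (p∤num , _) = ≢-nonZero {q} λ { refl → p∤num (p ℕ.∣0) }

1^n≡1 : ∀ n → 1ℚ ^ n ≡ 1ℚ
1^n≡1 zero    = refl
1^n≡1 (suc n) = trans (*-identityˡ (1ℚ ^ n)) (1^n≡1 n)

F₁≡1 : ∀ d z → F d 1 z ≡ 1ℚ
F₁≡1 d z = cong (λ a → a * 1ℚ + 0ℚ) (1^n≡1 d)

F-nonZero : ∀ d p z → AllUnits d p z → ∀ s → NonZero (F d (p ℕ.^ s) z)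
F-nonZero d p z units zero    = subst NonZero (sym (F₁≡1 d z)) _
F-nonZero d p z units (suc s) =
  isPAdicUnit⇒nonZero p (F d (p ℕ.^ suc s) z) (units (suc s) (ℕ.s≤s ℕ.z≤n))

-- Indexed from s = 0, so that the first quotient is F_p(z) / F_1(z).  The
-- units hypothesis serves only to make the division legitimate.
quotient : ∀ d p z → AllUnits d p z → ℕ → ℚ
quotient d p z units s =
  (F d (p ℕ.^ suc s) z ÷ F d (p ℕ.^ s) z) {{F-nonZero d p z units s}}

{-# OPTIONS --safe #-}
module Submission where

-- Write p = 2m + 1, z = ε and A n = α n ^ d · z ^ n.  Then A (b + p x) = w b x · A x
-- for b < p, where w b is p-adically Lipschitz: w b (x + p ^ j) ≡ w b x mod p ^ (j + 1).
-- With the transfer operator (L φ) x = Σ_{b<p} w b x · φ (b + p x) we have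
-- F_{p^s} = (L ^ s 1) 0.  L maps Lipschitz functions to constants plus p times
-- Lipschitz functions, so it is a rank one operator modulo p, and comparing
-- consecutive iterates gives Dwork's congruences
-- F_{p^(s+2)} / F_{p^(s+1)} ≡ F_{p^(s+1)} / F_{p^s} mod p ^ (s + 1).
-- The limit is therefore F_{p²} / F_p modulo p², and it remains to see that L 1 is
-- constant modulo p².  The weights with b > m vanish modulo p ^ d.  For b ≤ m the
-- reflection b ↦ m - b preserves w b 0 modulo p (by the choice of the sign z), and
-- w b x · w (m - b) x is independent of x modulo p²; hence so is w b x + w (m - b) x.

open import Algebra.Bundles using (CommutativeMonoid; CommutativeRing)
import Algebra.Definitions.RawMonoid as RawMonoidDefs
open import Data.Fin.Base using (toℕ)
open import Data.Integer.Base as ℤ using (ℤ; +_)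
import Data.Integer.Divisibility as ℤ
import Data.Integer.Properties as ℤ
open import Data.Nat.Base as ℕ using (ℕ; zero; suc; s≤s; z≤n; _≤_; _!)
import Data.Nat.Coprimality as Coprimality
import Data.Nat.Divisibility as ℕ
import Data.Nat.DivMod as ℕ
open import Data.Nat.GCD using (module Bézout)
open import Data.Nat.Primality using (Prime; euclidsLemma; prime⇒irreducible; prime⇒nonTrivial; prime⇒nonZero; ¬prime[1])
import Data.Nat.Properties as ℕ
open import Data.Nat.Properties using (_!≢0)
import Data.Nat.Tactic.RingSolver as ℕSolver
open import Data.Product.Base using (_×_; _,_; ∃-syntax; Σ-syntax; proj₁; proj₂)
open import Data.Rational.Base hiding (_≤_)
open import Data.Rational.Properties
open import Data.Rational.Unnormalised.Base as ℚᵘ using (mkℚᵘ; *≡*)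
import Data.Rational.Unnormalised.Properties as ℚᵘ
open import Data.Sum.Base using (inj₁; inj₂)
open import Level using (0ℓ)
open import Relation.Binary.PropositionalEquality using (_≡_; _≢_; refl; sym; trans; cong; cong₂; subst; subst₂; module ≡-Reasoning)
open import Relation.Nullary.Decidable.Core using (dec⇒maybe)
open import Relation.Nullary.Negation.Core using (¬_; contradiction)
open import Tactic.RingSolver using (solve-∀)
open import Tactic.RingSolver.Core.AlmostCommutativeRing using (AlmostCommutativeRing; fromCommutativeRing)
open import Algebra.Properties.CommutativeSemiring.Exp (CommutativeRing.commutativeSemiring +-*-commutativeRing) using (^-homo-*; ^-assocʳ; ^-distrib-*)
open import Defs

-- Dwork's congruences give F_{p²} / F_p ≡ F_p only modulo p, so the theorem asks for one more power
-- of p at the first step alone. The operator argument needs just the integrality and the Lipschitz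
-- property of the weights. The obstacle there is `c x` = α (p x) / α x, an estimate usually read
-- off from the p-adic gamma function. Here `c` is instead a product of quotients η (2 i) / η (2 i +
-- 1), where `η` is defined at all naturals: as p ^ k is odd, even and odd arguments cover the same
-- classes modulo p ^ k, and the quotients cancel over a window of length p ^ k. The same `η` yields
-- the second-order statement. Modulo p² it is a geometric progression in its argument, so c x
-- behaves like ρ ^ (- x) and η (2 x) like η 0 · ρ ^ (2 x). Hence c x · c x · η (2 x) is constant,
-- which is the case b = 0 of the product formula; the other b follow by moving one ratio at a time.
-- All computations stay in the rationals with denominator prime to p; ℤₚ appears only for the
-- limit.

ℚ-ring : AlmostCommutativeRing 0ℓ 0ℓ
ℚ-ring = fromCommutativeRing +-*-commutativeRing (λ x → dec⇒maybe (0ℚ ≟ x))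

-- Finite sums and products indexed by natural numbers

module RangeFold (M : CommutativeMonoid 0ℓ 0ℓ) where
  open CommutativeMonoid M renaming (refl to ≈-refl; sym to ≈-sym; trans to ≈-trans; ε to e)
  open import Relation.Binary.Reasoning.Setoid setoid
  open RawMonoidDefs rawMonoid using () renaming (sum to fold)

  range : ℕ → (ℕ → Carrier) → Carrier
  range zero    f = e
  range (suc n) f = f 0 ∙ range n (λ i → f (suc i))

  fold≈range : ∀ n f → fold {n} (λ i → f (toℕ i)) ≈ range n f
  fold≈range zero    f = ≈-refl
  fold≈range (suc n) f = ∙-congˡ (fold≈range n (λ i → f (suc i)))

  range-cong : ∀ n {f g} → (∀ i → i ℕ.< n → f i ≈ g i) → range n f ≈ range n g
  range-cong zero    h = ≈-refl
  range-cong (suc n) h = ∙-cong (h 0 (s≤s z≤n)) (range-cong n λ i i<n → h (suc i) (s≤s i<n))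

  range-∙ : ∀ n f g → range n (λ i → f i ∙ g i) ≈ range n f ∙ range n g
  range-∙ zero    f g = ≈-sym (identityˡ e)
  range-∙ (suc n) f g = begin
    (f 0 ∙ g 0) ∙ range n (λ i → f (suc i) ∙ g (suc i)) ≈⟨ ∙-congˡ (range-∙ n (λ i → f (suc i)) (λ i → g (suc i))) ⟩
    (f 0 ∙ g 0) ∙ (fs ∙ gs)                            ≈⟨ assoc _ _ _ ⟩
    f 0 ∙ (g 0 ∙ (fs ∙ gs))                            ≈⟨ ∙-congˡ (assoc _ _ _) ⟨
    f 0 ∙ ((g 0 ∙ fs) ∙ gs)                            ≈⟨ ∙-congˡ (∙-congʳ (comm _ _)) ⟩
    f 0 ∙ ((fs ∙ g 0) ∙ gs)                            ≈⟨ ∙-congˡ (assoc _ _ _) ⟩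
    f 0 ∙ (fs ∙ (g 0 ∙ gs))                            ≈⟨ assoc _ _ _ ⟨
    (f 0 ∙ fs) ∙ (g 0 ∙ gs)                            ∎
    where
    fs = range n (λ i → f (suc i))
    gs = range n (λ i → g (suc i))

  range-+ : ∀ a b f → range (a ℕ.+ b) f ≈ range a f ∙ range b (λ i → f (a ℕ.+ i))
  range-+ zero    b f = ≈-sym (identityˡ _)
  range-+ (suc a) b f = ≈-trans (∙-congˡ (range-+ a b (λ i → f (suc i)))) (≈-sym (assoc _ _ _))

  range-last : ∀ n f → range (suc n) f ≈ range n f ∙ f n
  range-last zero    f = comm _ _
  range-last (suc n) f = ≈-trans (∙-congˡ (range-last n (λ i → f (suc i)))) (≈-sym (assoc _ _ _))

  -- Indices below a N are written with two digits in base N; the outer index is the leading digit,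
  -- the order in which iterating `L` produces the digits.
  range-* : ∀ a N f → range (a ℕ.* N) f ≈ range a (λ b → range N (λ n → f (n ℕ.+ N ℕ.* b)))
  range-* zero    N f = ≈-refl
  range-* (suc a) N f = begin
    range (N ℕ.+ a ℕ.* N) f
      ≈⟨ range-+ N (a ℕ.* N) f ⟩
    range N f ∙ range (a ℕ.* N) (λ i → f (N ℕ.+ i))
      ≈⟨ ∙-cong (range-cong N λ n _ → reflexive (cong f (first n))) (range-* a N (λ i → f (N ℕ.+ i))) ⟩
    range N (λ n → f (n ℕ.+ N ℕ.* 0)) ∙ range a (λ b → range N (λ n → f (N ℕ.+ (n ℕ.+ N ℕ.* b))))
      ≈⟨ ∙-congˡ (range-cong a λ b _ → range-cong N λ n _ → reflexive (cong f (shift n b))) ⟩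
    range N (λ n → f (n ℕ.+ N ℕ.* 0)) ∙ range a (λ b → range N (λ n → f (n ℕ.+ N ℕ.* suc b))) ∎
    where
    first : ∀ n → n ≡ n ℕ.+ N ℕ.* 0
    first n = sym (trans (cong (n ℕ.+_) (ℕ.*-zeroʳ N)) (ℕ.+-identityʳ n))
    shift : ∀ n b → N ℕ.+ (n ℕ.+ N ℕ.* b) ≡ n ℕ.+ N ℕ.* suc b
    shift n b = trans (sym (ℕ.+-assoc N n _)) (trans (cong (ℕ._+ N ℕ.* b) (ℕ.+-comm N n))
      (trans (ℕ.+-assoc n N _) (cong (n ℕ.+_) (sym (ℕ.*-suc N b)))))

  range-reverse : ∀ m f → range (suc m) f ≈ range (suc m) (λ i → f (m ℕ.∸ i))
  range-reverse zero    f = ≈-refl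
  range-reverse (suc m) f = begin
    range (suc (suc m)) f                        ≈⟨ range-last (suc m) f ⟩
    range (suc m) f ∙ f (suc m)                  ≈⟨ comm _ _ ⟩
    f (suc m) ∙ range (suc m) f                  ≈⟨ ∙-congˡ (range-reverse m f) ⟩
    f (suc m) ∙ range (suc m) (λ i → f (m ℕ.∸ i)) ∎

open RangeFold +-0-commutativeMonoid using () renaming
  ( range to Σ<; fold≈range to sum≡Σ; range-cong to Σ-cong; range-∙ to Σ-+; range-* to Σ-block
  ; range-+ to Σ-split; range-reverse to Σ-reverse)

open RangeFold *-1-commutativeMonoid using () renaming
  ( range to Π<; fold≈range to product≡Π; range-cong to Π-cong; range-∙ to Π-*
  ; range-+ to Π-split; range-last to Π-last; range-reverse to Π-reverse)

*-Σ : ∀ c n f → Σ< n (λ i → c * f i) ≡ c * Σ< n f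
*-Σ c zero    f = sym (*-zeroʳ c)
*-Σ c (suc n) f = trans (cong (λ y → c * f 0 + y) (*-Σ c n (λ i → f (suc i)))) (sym (*-distribˡ-+ c (f 0) (Σ< n (λ i → f (suc i)))))

-- Integers and fractions inside the rationals

ℤ→ℚ-mkℚ : ∀ n → ℤ→ℚ n ≡ mkℚ n 0 (Coprimality.sym (Coprimality.1-coprimeTo ℤ.∣ n ∣))
ℤ→ℚ-mkℚ n = ↥p/↧p≡p (mkℚ n 0 _)

ℤ→ℚ-injective : ∀ {m n} → ℤ→ℚ m ≡ ℤ→ℚ n → m ≡ n
ℤ→ℚ-injective {m} {n} eq = cong ↥_ (trans (sym (ℤ→ℚ-mkℚ m)) (trans eq (ℤ→ℚ-mkℚ n)))

ℤ→ℚ-+ : ∀ m n → ℤ→ℚ (m ℤ.+ n) ≡ ℤ→ℚ m + ℤ→ℚ n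
ℤ→ℚ-+ m n = trans (cong ℤ→ℚ (sym (cong₂ ℤ._+_ (ℤ.*-identityʳ m) (ℤ.*-identityʳ n))))
  (sym (cong₂ _+_ (ℤ→ℚ-mkℚ m) (ℤ→ℚ-mkℚ n)))

ℤ→ℚ-* : ∀ m n → ℤ→ℚ (m ℤ.* n) ≡ ℤ→ℚ m * ℤ→ℚ n
ℤ→ℚ-* m n = sym (cong₂ _*_ (ℤ→ℚ-mkℚ m) (ℤ→ℚ-mkℚ n))

ℤ→ℚ-neg : ∀ n → ℤ→ℚ (ℤ.- n) ≡ - ℤ→ℚ n
ℤ→ℚ-neg n = begin
  ℤ→ℚ (ℤ.- n)                          ≡⟨ lemma (ℤ→ℚ n) (ℤ→ℚ (ℤ.- n)) ⟩
  - ℤ→ℚ n + (ℤ→ℚ n + ℤ→ℚ (ℤ.- n))      ≡⟨ cong (λ y → - ℤ→ℚ n + y) (ℤ→ℚ-+ n (ℤ.- n)) ⟨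
  - ℤ→ℚ n + ℤ→ℚ (n ℤ.+ (ℤ.- n))        ≡⟨ cong (λ i → - ℤ→ℚ n + ℤ→ℚ i) (ℤ.+-inverseʳ n) ⟩
  - ℤ→ℚ n + 0ℚ                         ≡⟨ +-identityʳ _ ⟩
  - ℤ→ℚ n                              ∎
  where
  open ≡-Reasoning
  lemma : ∀ x z → z ≡ - x + (x + z)
  lemma = solve-∀ ℚ-ring

ι-+ : ∀ m n → ℕ→ℚ (m ℕ.+ n) ≡ ℕ→ℚ m + ℕ→ℚ n
ι-+ m n = ℤ→ℚ-+ (+ m) (+ n)

ι-* : ∀ m n → ℕ→ℚ (m ℕ.* n) ≡ ℕ→ℚ m * ℕ→ℚ n
ι-* m n = trans (cong ℤ→ℚ (ℤ.pos-* m n)) (ℤ→ℚ-* (+ m) (+ n))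

q*↧≡↥ : ∀ q → q * ℤ→ℚ (↧ q) ≡ ℤ→ℚ (↥ q)
q*↧≡↥ q@(mkℚ n d _) = trans (cong (q *_) (ℤ→ℚ-mkℚ (↧ q)))
  (fromℚᵘ-cong {mkℚᵘ (n ℤ.* + suc d) (d ℕ.* 1)} {mkℚᵘ n 0}
    (*≡* (trans (ℤ.*-identityʳ _) (cong (λ k → n ℤ.* + suc k) (sym (ℕ.*-identityʳ d))))))

/-*-cancel : ∀ n d .{{_ : ℕ.NonZero d}} → (n / d) * ℕ→ℚ d ≡ ℤ→ℚ n
/-*-cancel n (suc d) = toℚᵘ-injective (begin
  toℚᵘ ((n / suc d) * ℕ→ℚ (suc d))           ≈⟨ toℚᵘ-homo-* (n / suc d) (ℕ→ℚ (suc d)) ⟩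
  toℚᵘ (n / suc d) ℚᵘ.* toℚᵘ (ℕ→ℚ (suc d))   ≈⟨ ℚᵘ.*-cong (toℚᵘ-fromℚᵘ (mkℚᵘ n d)) (toℚᵘ-fromℚᵘ (mkℚᵘ (+ suc d) 0)) ⟩
  mkℚᵘ (n ℤ.* + suc d) (d ℕ.* 1)             ≈⟨ *≡* (trans (ℤ.*-identityʳ _) (cong (λ k → n ℤ.* + suc k) (sym (ℕ.*-identityʳ d)))) ⟩
  mkℚᵘ n 0                                   ≈⟨ toℚᵘ-fromℚᵘ (mkℚᵘ n 0) ⟨
  toℚᵘ (ℤ→ℚ n)                               ∎)
  where
  open ℚᵘ.≃-Reasoning

-- The value at 0 is junk.
invℕ : ℕ → ℚ
invℕ zero    = 0ℚ
invℕ (suc n) = + 1 / suc n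

ι*invℕ : ∀ n .{{_ : ℕ.NonZero n}} → ℕ→ℚ n * invℕ n ≡ 1ℚ
ι*invℕ (suc n) = trans (*-comm (ℕ→ℚ (suc n)) (+ 1 / suc n)) (/-*-cancel (+ 1) (suc n))

invℕ-unique : ∀ n {x} .{{_ : ℕ.NonZero n}} → ℕ→ℚ n * x ≡ 1ℚ → invℕ n ≡ x
invℕ-unique n {x} eq = begin
  invℕ n                    ≡⟨ *-identityʳ _ ⟨
  invℕ n * 1ℚ               ≡⟨ cong (invℕ n *_) eq ⟨
  invℕ n * (ℕ→ℚ n * x)      ≡⟨ lemma (invℕ n) (ℕ→ℚ n) x ⟩
  ℕ→ℚ n * invℕ n * x        ≡⟨ cong (_* x) (ι*invℕ n) ⟩
  1ℚ * x                    ≡⟨ *-identityˡ x ⟩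
  x                         ∎
  where
  open ≡-Reasoning
  lemma : ∀ v u x → v * (u * x) ≡ u * v * x
  lemma = solve-∀ ℚ-ring

-- The value 0 at 0 makes multiplicativity unconditional, so fractions can be multiplied without
-- positivity hypotheses.
invℕ-* : ∀ m n → invℕ (m ℕ.* n) ≡ invℕ m * invℕ n
invℕ-* zero      n         = sym (*-zeroˡ (invℕ n))
invℕ-* m@(suc _) zero      = trans (cong invℕ (ℕ.*-zeroʳ m)) (sym (*-zeroʳ (invℕ m)))
invℕ-* m@(suc _) n@(suc _) = invℕ-unique (m ℕ.* n) (begin
  ℕ→ℚ (m ℕ.* n) * (invℕ m * invℕ n)          ≡⟨ cong (_* (invℕ m * invℕ n)) (ι-* m n) ⟩
  ℕ→ℚ m * ℕ→ℚ n * (invℕ m * invℕ n)          ≡⟨ lemma (ℕ→ℚ m) (ℕ→ℚ n) (invℕ m) (invℕ n) ⟩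
  ℕ→ℚ m * invℕ m * (ℕ→ℚ n * invℕ n)          ≡⟨ cong₂ _*_ (ι*invℕ m) (ι*invℕ n) ⟩
  1ℚ                                         ∎)
  where
  open ≡-Reasoning
  lemma : ∀ u v u⁻ v⁻ → u * v * (u⁻ * v⁻) ≡ u * u⁻ * (v * v⁻)
  lemma = solve-∀ ℚ-ring

frac : ℕ → ℕ → ℚ
frac a b = ℕ→ℚ a * invℕ b

frac-* : ∀ a b c d → frac a b * frac c d ≡ frac (a ℕ.* c) (b ℕ.* d)
frac-* a b c d = trans (lemma (ℕ→ℚ a) (invℕ b) (ℕ→ℚ c) (invℕ d))
  (sym (cong₂ _*_ (ι-* a c) (invℕ-* b d)))
  where
  lemma : ∀ a b c d → a * b * (c * d) ≡ a * c * (b * d)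
  lemma = solve-∀ ℚ-ring

frac-scale : ∀ c .{{_ : ℕ.NonZero c}} a b → frac (c ℕ.* a) (c ℕ.* b) ≡ frac a b
frac-scale c a b = trans (sym (frac-* c c a b)) (trans (cong (_* frac a b) (ι*invℕ c)) (*-identityˡ _))

-- The localization of ℤ at p: integrality, units and congruences

module Localization (p : ℕ) (pr : Prime p) where

  p∤1 : ¬ p ℕ.∣ 1
  p∤1 p∣1 = ¬prime[1] (subst Prime (ℕ.∣1⇒≡1 p∣1) pr)

  p∤* : ∀ {a b} → ¬ p ℕ.∣ a → ¬ p ℕ.∣ b → ¬ p ℕ.∣ a ℕ.* b
  p∤* {a} {b} p∤a p∤b p∣ab with euclidsLemma a b pr p∣ab
  ... | inj₁ p∣a = p∤a p∣a
  ... | inj₂ p∣b = p∤b p∣b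

  p∤ℤ* : ∀ a b → ¬ p ℕ.∣ ℤ.∣ a ∣ → ¬ p ℕ.∣ ℤ.∣ b ∣ → ¬ p ℕ.∣ ℤ.∣ a ℤ.* b ∣
  p∤ℤ* a b p∤a p∤b p∣ab = p∤* p∤a p∤b (subst (p ℕ.∣_) (ℤ.abs-* a b) p∣ab)

  -- Any denominator prime to p is accepted, not only the reduced one, so that sums and products
  -- need no reduction to lowest terms.
  record Integral (x : ℚ) : Set where
    constructor mkIntegral
    field
      den num : ℤ
      p∤den   : ¬ p ℕ.∣ ℤ.∣ den ∣
      clear   : x * ℤ→ℚ den ≡ ℤ→ℚ num

  integral-ℤ : ∀ n → Integral (ℤ→ℚ n)
  integral-ℤ n = mkIntegral (+ 1) n p∤1 (*-identityʳ _)

  integral-ι : ∀ n → Integral (ℕ→ℚ n)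
  integral-ι n = integral-ℤ (+ n)

  integral-0 : Integral 0ℚ
  integral-0 = integral-ℤ (+ 0)

  integral-1 : Integral 1ℚ
  integral-1 = integral-ℤ (+ 1)

  integral-+ : ∀ {x y} → Integral x → Integral y → Integral (x + y)
  integral-+ {x} {y} (mkIntegral a m p∤a xa) (mkIntegral b n p∤b yb) =
    mkIntegral (a ℤ.* b) (m ℤ.* b ℤ.+ n ℤ.* a) (p∤ℤ* a b p∤a p∤b) (begin
      (x + y) * ℤ→ℚ (a ℤ.* b)                     ≡⟨ cong ((x + y) *_) (ℤ→ℚ-* a b) ⟩
      (x + y) * (ℤ→ℚ a * ℤ→ℚ b)                   ≡⟨ lemma x y (ℤ→ℚ a) (ℤ→ℚ b) ⟩
      x * ℤ→ℚ a * ℤ→ℚ b + y * ℤ→ℚ b * ℤ→ℚ a       ≡⟨ cong₂ (λ u v → u * ℤ→ℚ b + v * ℤ→ℚ a) xa yb ⟩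
      ℤ→ℚ m * ℤ→ℚ b + ℤ→ℚ n * ℤ→ℚ a               ≡⟨ cong₂ _+_ (ℤ→ℚ-* m b) (ℤ→ℚ-* n a) ⟨
      ℤ→ℚ (m ℤ.* b) + ℤ→ℚ (n ℤ.* a)               ≡⟨ ℤ→ℚ-+ (m ℤ.* b) (n ℤ.* a) ⟨
      ℤ→ℚ (m ℤ.* b ℤ.+ n ℤ.* a)                   ∎)
    where
    open ≡-Reasoning
    lemma : ∀ x y a b → (x + y) * (a * b) ≡ x * a * b + y * b * a
    lemma = solve-∀ ℚ-ring

  integral-* : ∀ {x y} → Integral x → Integral y → Integral (x * y)
  integral-* {x} {y} (mkIntegral a m p∤a xa) (mkIntegral b n p∤b yb) =
    mkIntegral (a ℤ.* b) (m ℤ.* n) (p∤ℤ* a b p∤a p∤b) (begin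
      x * y * ℤ→ℚ (a ℤ.* b)           ≡⟨ cong ((x * y) *_) (ℤ→ℚ-* a b) ⟩
      x * y * (ℤ→ℚ a * ℤ→ℚ b)         ≡⟨ lemma x y (ℤ→ℚ a) (ℤ→ℚ b) ⟩
      x * ℤ→ℚ a * (y * ℤ→ℚ b)         ≡⟨ cong₂ _*_ xa yb ⟩
      ℤ→ℚ m * ℤ→ℚ n                   ≡⟨ ℤ→ℚ-* m n ⟨
      ℤ→ℚ (m ℤ.* n)                   ∎)
    where
    open ≡-Reasoning
    lemma : ∀ x y a b → x * y * (a * b) ≡ x * a * (y * b)
    lemma = solve-∀ ℚ-ring

  integral-neg : ∀ {x} → Integral x → Integral (- x)
  integral-neg {x} (mkIntegral a m p∤a xa) = mkIntegral a (ℤ.- m) p∤a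
    (trans (sym (neg-distribˡ-* x (ℤ→ℚ a))) (trans (cong -_ xa) (sym (ℤ→ℚ-neg m))))

  integral-^ : ∀ {x} n → Integral x → Integral (x ^ n)
  integral-^ zero    _ = integral-1
  integral-^ (suc n) h = integral-* h (integral-^ n h)

  integral-Π : ∀ n {f} → (∀ i → i ℕ.< n → Integral (f i)) → Integral (Π< n f)
  integral-Π zero    h = integral-1
  integral-Π (suc n) h = integral-* (h 0 (s≤s z≤n)) (integral-Π n λ i i<n → h (suc i) (s≤s i<n))

  isPIntegral⇒integral : ∀ {x} → IsPIntegral p x → Integral x
  isPIntegral⇒integral {x} p∤↧ = mkIntegral (↧ x) (↥ x) p∤↧ (q*↧≡↥ x)

  num*den : ∀ {x y} a b → x * ℤ→ℚ a ≡ y → x * ℤ→ℚ b * ℤ→ℚ a ≡ y * ℤ→ℚ b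
  num*den {x} a b refl = lemma x (ℤ→ℚ a) (ℤ→ℚ b)
    where
    lemma : ∀ x a b → x * b * a ≡ x * a * b
    lemma = solve-∀ ℚ-ring

  -- If p divided the reduced denominator, cross-multiplying with `b` would make it divide the
  -- numerator too, against coprimality.
  integral⇒isPIntegral : ∀ {x} → Integral x → IsPIntegral p x
  integral⇒isPIntegral {x@(mkℚ _ _ c)} (mkIntegral b n p∤b xb) p∣↧ =
    p∤1 (subst (p ℕ.∣_) (Coprimality.recompute c (p∣↥ , p∣↧)) ℕ.∣-refl)
    where
    cross : ↥ x ℤ.* b ≡ n ℤ.* ↧ x
    cross = ℤ→ℚ-injective (begin
      ℤ→ℚ (↥ x ℤ.* b)           ≡⟨ ℤ→ℚ-* (↥ x) b ⟩
      ℤ→ℚ (↥ x) * ℤ→ℚ b         ≡⟨ num*den {x} (↧ x) b (q*↧≡↥ x) ⟨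
      x * ℤ→ℚ b * ℤ→ℚ (↧ x)     ≡⟨ cong (_* ℤ→ℚ (↧ x)) xb ⟩
      ℤ→ℚ n * ℤ→ℚ (↧ x)         ≡⟨ ℤ→ℚ-* n (↧ x) ⟨
      ℤ→ℚ (n ℤ.* ↧ x)           ∎)
      where open ≡-Reasoning
    p∣↥*b : p ℕ.∣ ℤ.∣ ↥ x ∣ ℕ.* ℤ.∣ b ∣
    p∣↥*b = subst (p ℕ.∣_) (trans (sym (ℤ.abs-* n (↧ x))) (trans (cong ℤ.∣_∣ (sym cross)) (ℤ.abs-* (↥ x) b)))
      (ℕ.∣-trans p∣↧ (ℕ.n∣m*n ℤ.∣ n ∣))
    p∣↥ : p ℕ.∣ ℤ.∣ ↥ x ∣
    p∣↥ with euclidsLemma ℤ.∣ ↥ x ∣ ℤ.∣ b ∣ pr p∣↥*b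
    ... | inj₁ p∣↥x = p∣↥x
    ... | inj₂ p∣b  = contradiction p∣b p∤b

  record Unit (u : ℚ) : Set where
    constructor mkUnit
    field
      integral     : Integral u
      inv          : ℚ
      inv-integral : Integral inv
      u*inv        : u * inv ≡ 1ℚ
  open Unit public

  unit-1 : Unit 1ℚ
  unit-1 = mkUnit integral-1 1ℚ integral-1 refl

  unit-* : ∀ {u v} → Unit u → Unit v → Unit (u * v)
  unit-* {u} {v} (mkUnit iu u⁻ iu⁻ uu⁻) (mkUnit iv v⁻ iv⁻ vv⁻) =
    mkUnit (integral-* iu iv) (u⁻ * v⁻) (integral-* iu⁻ iv⁻) (trans (lemma u v u⁻ v⁻) (cong₂ _*_ uu⁻ vv⁻))
    where
    lemma : ∀ u v u⁻ v⁻ → u * v * (u⁻ * v⁻) ≡ u * u⁻ * (v * v⁻)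
    lemma = solve-∀ ℚ-ring

  unit-inv : ∀ {u} (U : Unit u) → Unit (inv U)
  unit-inv {u} (mkUnit iu u⁻ iu⁻ uu⁻) = mkUnit iu⁻ u iu (trans (*-comm u⁻ u) uu⁻)

  unit-^ : ∀ {u} n → Unit u → Unit (u ^ n)
  unit-^ zero    _ = unit-1
  unit-^ (suc n) h = unit-* h (unit-^ n h)

  unit-Π : ∀ n {f} → (∀ i → i ℕ.< n → Unit (f i)) → Unit (Π< n f)
  unit-Π zero    h = unit-1
  unit-Π (suc n) h = unit-* (h 0 (s≤s z≤n)) (unit-Π n λ i i<n → h (suc i) (s≤s i<n))

  unit-ι : ∀ {n} → ¬ p ℕ.∣ n → Unit (ℕ→ℚ n)
  unit-ι {zero}  p∤n = contradiction (p ℕ.∣0) p∤n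
  unit-ι {suc n} p∤n = mkUnit (integral-ι (suc n)) (invℕ (suc n))
    (mkIntegral (+ suc n) (+ 1) p∤n (/-*-cancel (+ 1) (suc n))) (ι*invℕ (suc n))

  unit-invℕ : ∀ {n} → ¬ p ℕ.∣ n → Unit (invℕ n)
  unit-invℕ {zero}  p∤n = contradiction (p ℕ.∣0) p∤n
  unit-invℕ {suc n} p∤n = unit-inv (unit-ι p∤n)

  record Divisible (k : ℕ) (x : ℚ) : Set where
    constructor mkDivisible
    field
      cofactor          : ℚ
      cofactor-integral : Integral cofactor
      factorisation     : x ≡ ℕ→ℚ (p ℕ.^ k) * cofactor
  open Divisible public

  integral⇒div : ∀ {x} → Integral x → Divisible 0 x
  integral⇒div {x} h = mkDivisible x h (sym (*-identityˡ x))

  div⇒integral : ∀ {k x} → Divisible k x → Integral x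
  div⇒integral {k} (mkDivisible q h refl) = integral-* (integral-ι (p ℕ.^ k)) h

  div-0 : ∀ {k} → Divisible k 0ℚ
  div-0 {k} = mkDivisible 0ℚ integral-0 (sym (*-zeroʳ (ℕ→ℚ (p ℕ.^ k))))

  div-+ : ∀ {k x y} → Divisible k x → Divisible k y → Divisible k (x + y)
  div-+ {k} (mkDivisible a ia refl) (mkDivisible b ib refl) =
    mkDivisible (a + b) (integral-+ ia ib) (sym (*-distribˡ-+ (ℕ→ℚ (p ℕ.^ k)) a b))

  div-neg : ∀ {k x} → Divisible k x → Divisible k (- x)
  div-neg {k} (mkDivisible a ia refl) =
    mkDivisible (- a) (integral-neg ia) (neg-distribʳ-* (ℕ→ℚ (p ℕ.^ k)) a)

  div-* : ∀ {j k x y} → Divisible j x → Divisible k y → Divisible (j ℕ.+ k) (x * y)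
  div-* {j} {k} (mkDivisible a ia refl) (mkDivisible b ib refl) =
    mkDivisible (a * b) (integral-* ia ib)
      (trans (lemma (ℕ→ℚ (p ℕ.^ j)) (ℕ→ℚ (p ℕ.^ k)) a b)
        (cong (_* (a * b)) (trans (sym (ι-* (p ℕ.^ j) (p ℕ.^ k))) (cong ℕ→ℚ (sym (ℕ.^-distribˡ-+-* p j k))))))
    where
    lemma : ∀ u v a b → (u * a) * (v * b) ≡ (u * v) * (a * b)
    lemma = solve-∀ ℚ-ring

  div-*ˡ : ∀ {k x y} → Integral x → Divisible k y → Divisible k (x * y)
  div-*ˡ h = div-* (integral⇒div h)

  div-p^ : ∀ k → Divisible k (ℕ→ℚ (p ℕ.^ k))
  div-p^ k = mkDivisible 1ℚ integral-1 (sym (*-identityʳ _))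

  div-weaken : ∀ {j k x} → j ℕ.≤ k → Divisible k x → Divisible j x
  div-weaken {j} {k} {x} j≤k (mkDivisible a ia eq) =
    mkDivisible (ℕ→ℚ (p ℕ.^ (k ℕ.∸ j)) * a) (integral-* (integral-ι (p ℕ.^ (k ℕ.∸ j))) ia) (begin
      x                                                  ≡⟨ eq ⟩
      ℕ→ℚ (p ℕ.^ k) * a                                  ≡⟨ cong (λ i → ℕ→ℚ (p ℕ.^ i) * a) (ℕ.m+[n∸m]≡n j≤k) ⟨
      ℕ→ℚ (p ℕ.^ (j ℕ.+ (k ℕ.∸ j))) * a                  ≡⟨ cong (λ i → ℕ→ℚ i * a) (ℕ.^-distribˡ-+-* p j (k ℕ.∸ j)) ⟩
      ℕ→ℚ (p ℕ.^ j ℕ.* p ℕ.^ (k ℕ.∸ j)) * a              ≡⟨ cong (_* a) (ι-* (p ℕ.^ j) (p ℕ.^ (k ℕ.∸ j))) ⟩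
      ℕ→ℚ (p ℕ.^ j) * ℕ→ℚ (p ℕ.^ (k ℕ.∸ j)) * a          ≡⟨ *-assoc (ℕ→ℚ (p ℕ.^ j)) (ℕ→ℚ (p ℕ.^ (k ℕ.∸ j))) a ⟩
      ℕ→ℚ (p ℕ.^ j) * (ℕ→ℚ (p ℕ.^ (k ℕ.∸ j)) * a)        ∎)
    where open ≡-Reasoning

  div-cancel : ∀ {k u x} → Unit u → Divisible k (u * x) → Divisible k x
  div-cancel {k} {u} {x} U h = subst (Divisible k) eq (div-*ˡ (inv-integral U) h)
    where
    lemma : ∀ v u x → v * (u * x) ≡ (u * v) * x
    lemma = solve-∀ ℚ-ring
    eq : inv U * (u * x) ≡ x
    eq = trans (lemma (inv U) u x) (trans (cong (_* x) (u*inv U)) (*-identityˡ x))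

  div-Σ : ∀ {k} n {f} → (∀ i → i ℕ.< n → Divisible k (f i)) → Divisible k (Σ< n f)
  div-Σ zero    h = div-0
  div-Σ (suc n) h = div-+ (h 0 (s≤s z≤n)) (div-Σ n λ i i<n → h (suc i) (s≤s i<n))

  unit⇒¬div : ∀ {u} → Unit u → ¬ Divisible 1 u
  unit⇒¬div {u} U h with subst (Divisible 1) (u*inv U) (subst (Divisible 1) (*-comm (inv U) u) (div-*ˡ (inv-integral U) h))
  ... | mkDivisible a (mkIntegral b n p∤b ab) eq = p∤b (subst (p ℕ.∣_) (sym abs-eq) (ℕ.m∣m*n ℤ.∣ n ∣))
    where
    p*n≡b : b ≡ + p ℤ.* n
    p*n≡b = ℤ→ℚ-injective (begin
      ℤ→ℚ b                             ≡⟨ *-identityˡ _ ⟨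
      1ℚ * ℤ→ℚ b                        ≡⟨ cong (_* ℤ→ℚ b) eq ⟩
      ℕ→ℚ (p ℕ.* 1) * a * ℤ→ℚ b         ≡⟨ *-assoc (ℕ→ℚ (p ℕ.* 1)) a (ℤ→ℚ b) ⟩
      ℕ→ℚ (p ℕ.* 1) * (a * ℤ→ℚ b)       ≡⟨ cong₂ _*_ (cong ℕ→ℚ (ℕ.*-identityʳ p)) ab ⟩
      ℕ→ℚ p * ℤ→ℚ n                     ≡⟨ ℤ→ℚ-* (+ p) n ⟨
      ℤ→ℚ (+ p ℤ.* n)                   ∎)
      where open ≡-Reasoning
    abs-eq : ℤ.∣ b ∣ ≡ p ℕ.* ℤ.∣ n ∣
    abs-eq = trans (cong ℤ.∣_∣ p*n≡b) (ℤ.abs-* (+ p) n)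

  infix 4 _≈_[_]
  record _≈_[_] (x y : ℚ) (k : ℕ) : Set where
    constructor mk≈
    field difference : Divisible k (x - y)
  open _≈_[_] public

  ≈-reflexive : ∀ {k x y} → x ≡ y → x ≈ y [ k ]
  ≈-reflexive {k} {x} refl = mk≈ (subst (Divisible k) (sym (+-inverseʳ x)) div-0)

  ≈-refl : ∀ {k x} → x ≈ x [ k ]
  ≈-refl = ≈-reflexive refl

  ≈-sym : ∀ {k x y} → x ≈ y [ k ] → y ≈ x [ k ]
  ≈-sym {k} {x} {y} (mk≈ h) = mk≈ (subst (Divisible k) (lemma x y) (div-neg h))
    where
    lemma : ∀ x y → - (x - y) ≡ y - x
    lemma = solve-∀ ℚ-ring

  ≈-trans : ∀ {k x y z} → x ≈ y [ k ] → y ≈ z [ k ] → x ≈ z [ k ]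
  ≈-trans {k} {x} {y} {z} (mk≈ g) (mk≈ h) = mk≈ (subst (Divisible k) (lemma x y z) (div-+ g h))
    where
    lemma : ∀ x y z → (x - y) + (y - z) ≡ x - z
    lemma = solve-∀ ℚ-ring

  ≈-weaken : ∀ {j k x y} → j ℕ.≤ k → x ≈ y [ k ] → x ≈ y [ j ]
  ≈-weaken j≤k (mk≈ h) = mk≈ (div-weaken j≤k h)

  ≈0⇒div : ∀ {k x} → x ≈ 0ℚ [ k ] → Divisible k x
  ≈0⇒div {k} {x} (mk≈ h) = subst (Divisible k) (+-identityʳ x) h

  div⇒≈0 : ∀ {k x} → Divisible k x → x ≈ 0ℚ [ k ]
  div⇒≈0 {k} {x} h = mk≈ (subst (Divisible k) (sym (+-identityʳ x)) h)

  ≈-+ : ∀ {k x x′ y y′} → x ≈ x′ [ k ] → y ≈ y′ [ k ] → x + y ≈ x′ + y′ [ k ]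
  ≈-+ {k} {x} {x′} {y} {y′} (mk≈ g) (mk≈ h) = mk≈ (subst (Divisible k) (lemma x x′ y y′) (div-+ g h))
    where
    lemma : ∀ x x′ y y′ → (x - x′) + (y - y′) ≡ (x + y) - (x′ + y′)
    lemma = solve-∀ ℚ-ring

  -- From x y - x′ y′ = x (y - y′) + y′ (x - x′): only the two multipliers x and y′ have to be
  -- integral.
  ≈-* : ∀ {k x x′ y y′} → Integral x → Integral y′ →
        x ≈ x′ [ k ] → y ≈ y′ [ k ] → x * y ≈ x′ * y′ [ k ]
  ≈-* {k} {x} {x′} {y} {y′} ix iy′ (mk≈ g) (mk≈ h) =
    mk≈ (subst (Divisible k) (lemma x x′ y y′) (div-+ (div-*ˡ ix h) (div-*ˡ iy′ g)))
    where
    lemma : ∀ x x′ y y′ → x * (y - y′) + y′ * (x - x′) ≡ x * y - x′ * y′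
    lemma = solve-∀ ℚ-ring

  ≈-*ˡ : ∀ {k x y y′} → Integral x → y ≈ y′ [ k ] → x * y ≈ x * y′ [ k ]
  ≈-*ˡ {k} {x} {y} {y′} ix (mk≈ h) = mk≈ (subst (Divisible k) (lemma x y y′) (div-*ˡ ix h))
    where
    lemma : ∀ x y y′ → x * (y - y′) ≡ x * y - x * y′
    lemma = solve-∀ ℚ-ring

  ≈-*ʳ : ∀ {k x x′ y} → Integral y → x ≈ x′ [ k ] → x * y ≈ x′ * y [ k ]
  ≈-*ʳ {k} {x} {x′} {y} iy h = ≈-trans (≈-reflexive (*-comm x y)) (≈-trans (≈-*ˡ iy h) (≈-reflexive (*-comm y x′)))

  ≈-^ : ∀ {k x y} n → Integral x → Integral y → x ≈ y [ k ] → x ^ n ≈ y ^ n [ k ]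
  ≈-^ zero    ix iy h = ≈-refl
  ≈-^ (suc n) ix iy h = ≈-* ix (integral-^ n iy) h (≈-^ n ix iy h)

  ≈-Π : ∀ {k} n {f g} → (∀ i → i ℕ.< n → Integral (f i)) → (∀ i → i ℕ.< n → Integral (g i)) →
        (∀ i → i ℕ.< n → f i ≈ g i [ k ]) → Π< n f ≈ Π< n g [ k ]
  ≈-Π zero    F G h = ≈-refl
  ≈-Π (suc n) F G h = ≈-* (F 0 (s≤s z≤n)) (integral-Π n λ i i<n → G (suc i) (s≤s i<n)) (h 0 (s≤s z≤n))
    (≈-Π n (λ i i<n → F (suc i) (s≤s i<n)) (λ i i<n → G (suc i) (s≤s i<n)) (λ i i<n → h (suc i) (s≤s i<n)))

  ≈-Σ : ∀ {k} n {f g} → (∀ i → i ℕ.< n → f i ≈ g i [ k ]) → Σ< n f ≈ Σ< n g [ k ]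
  ≈-Σ zero    h = ≈-refl
  ≈-Σ (suc n) h = ≈-+ (h 0 (s≤s z≤n)) (≈-Σ n λ i i<n → h (suc i) (s≤s i<n))

  ≈-cancel : ∀ {k u x y} → Unit u → u * x ≈ u * y [ k ] → x ≈ y [ k ]
  ≈-cancel {k} {u} {x} {y} U (mk≈ h) = mk≈ (div-cancel U (subst (Divisible k) (lemma u x y) h))
    where
    lemma : ∀ u x y → u * x - u * y ≡ u * (x - y)
    lemma = solve-∀ ℚ-ring

  -- Adding a multiple of p ^ k on each side keeps the hypothesis a polynomial identity over ℕ, free
  -- of truncated subtraction.
  ≈-ι : ∀ k {a b} u v → a ℕ.+ p ℕ.^ k ℕ.* u ≡ b ℕ.+ p ℕ.^ k ℕ.* v → ℕ→ℚ a ≈ ℕ→ℚ b [ k ]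
  ≈-ι k {a} {b} u v eq = mk≈ (subst (Divisible k) diff (div-+ (multiple v) (div-neg (multiple u))))
    where
    P = p ℕ.^ k
    multiple : ∀ n → Divisible k (ℕ→ℚ (P ℕ.* n))
    multiple n = mkDivisible (ℕ→ℚ n) (integral-ι n) (ι-* P n)
    lemma₁ : ∀ x y b → y - x ≡ (b + y) - (b + x)
    lemma₁ = solve-∀ ℚ-ring
    lemma₂ : ∀ x a b → (a + x) - (b + x) ≡ a - b
    lemma₂ = solve-∀ ℚ-ring
    open ≡-Reasoning
    diff : ℕ→ℚ (P ℕ.* v) - ℕ→ℚ (P ℕ.* u) ≡ ℕ→ℚ a - ℕ→ℚ b
    diff = begin
      ℕ→ℚ (P ℕ.* v) - ℕ→ℚ (P ℕ.* u)                           ≡⟨ lemma₁ (ℕ→ℚ (P ℕ.* u)) (ℕ→ℚ (P ℕ.* v)) (ℕ→ℚ b) ⟩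
      (ℕ→ℚ b + ℕ→ℚ (P ℕ.* v)) - (ℕ→ℚ b + ℕ→ℚ (P ℕ.* u))       ≡⟨ cong (_- (ℕ→ℚ b + ℕ→ℚ (P ℕ.* u))) (trans (sym (ι-+ b (P ℕ.* v))) (trans (cong ℕ→ℚ (sym eq)) (ι-+ a (P ℕ.* u)))) ⟩
      (ℕ→ℚ a + ℕ→ℚ (P ℕ.* u)) - (ℕ→ℚ b + ℕ→ℚ (P ℕ.* u))       ≡⟨ lemma₂ (ℕ→ℚ (P ℕ.* u)) (ℕ→ℚ a) (ℕ→ℚ b) ⟩
      ℕ→ℚ a - ℕ→ℚ b                                           ∎

  integral-frac : ∀ a {b} → ¬ p ℕ.∣ b → Integral (frac a b)
  integral-frac a p∤b = integral-* (integral-ι a) (integral (unit-invℕ p∤b))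

  unit-frac : ∀ {a b} → ¬ p ℕ.∣ a → ¬ p ℕ.∣ b → Unit (frac a b)
  unit-frac p∤a p∤b = unit-* (unit-ι p∤a) (unit-invℕ p∤b)

  p∤⇒nonZero : ∀ {n} → ¬ p ℕ.∣ n → ℕ.NonZero n
  p∤⇒nonZero {zero}  p∤0 = contradiction (p ℕ.∣0) p∤0
  p∤⇒nonZero {suc n} _   = _

  -- Cross-multiplied, because in `t-swap` the fractions are congruent although their numerators and
  -- denominators need not be so separately.
  ≈-frac-cross : ∀ {k a a′ b b′} → ¬ p ℕ.∣ b → ¬ p ℕ.∣ b′ →
                 ℕ→ℚ a * ℕ→ℚ b′ ≈ ℕ→ℚ a′ * ℕ→ℚ b [ k ] → frac a b ≈ frac a′ b′ [ k ]
  ≈-frac-cross {k} {a} {a′} {b} {b′} p∤b p∤b′ h = ≈-cancel (unit-* (unit-ι p∤b) (unit-ι p∤b′))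
    (≈-trans (≈-reflexive left) (≈-trans h (≈-reflexive right)))
    where
    lemma : ∀ a b b⁻ b′ → b * b′ * (a * b⁻) ≡ a * b′ * (b * b⁻)
    lemma = solve-∀ ℚ-ring
    cancel : ∀ a b b′ → ¬ p ℕ.∣ b → ℕ→ℚ b * ℕ→ℚ b′ * frac a b ≡ ℕ→ℚ a * ℕ→ℚ b′
    cancel a b b′ p∤b = trans (lemma (ℕ→ℚ a) (ℕ→ℚ b) (invℕ b) (ℕ→ℚ b′))
      (trans (cong ((ℕ→ℚ a * ℕ→ℚ b′) *_) (ι*invℕ b {{p∤⇒nonZero p∤b}})) (*-identityʳ _))
    left : ℕ→ℚ b * ℕ→ℚ b′ * frac a b ≡ ℕ→ℚ a * ℕ→ℚ b′
    left = cancel a b b′ p∤b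
    right : ℕ→ℚ a′ * ℕ→ℚ b ≡ ℕ→ℚ b * ℕ→ℚ b′ * frac a′ b′
    right = trans (sym (cancel a′ b′ b p∤b′)) (cong (_* frac a′ b′) (*-comm (ℕ→ℚ b′) (ℕ→ℚ b)))

  ≈-frac : ∀ {k a a′ b b′} → ¬ p ℕ.∣ b → ¬ p ℕ.∣ b′ →
           ℕ→ℚ a ≈ ℕ→ℚ a′ [ k ] → ℕ→ℚ b ≈ ℕ→ℚ b′ [ k ] → frac a b ≈ frac a′ b′ [ k ]
  ≈-frac {k} {a} {a′} {b} {b′} p∤b p∤b′ h g =
    ≈-frac-cross {k} {a} {a′} p∤b p∤b′ (≈-* (integral-ι a) (integral-ι b) h (≈-sym g))

  isPAdicUnit⇒unit : ∀ {u} → IsPAdicUnit p u → Unit u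
  isPAdicUnit⇒unit {u} isUnit@(p∤↥ , p∤↧) = mkUnit (isPIntegral⇒integral p∤↧) (1/ u)
    (mkIntegral (↥ u) (↧ u) p∤↥ (begin
      1/ u * ℤ→ℚ (↥ u)             ≡⟨ cong (1/ u *_) (q*↧≡↥ u) ⟨
      1/ u * (u * ℤ→ℚ (↧ u))       ≡⟨ *-assoc (1/ u) u _ ⟨
      1/ u * u * ℤ→ℚ (↧ u)         ≡⟨ cong (_* ℤ→ℚ (↧ u)) (*-inverseˡ u) ⟩
      1ℚ * ℤ→ℚ (↧ u)               ≡⟨ *-identityˡ _ ⟩
      ℤ→ℚ (↧ u)                    ∎))
    (*-inverseʳ u)
    where
    open ≡-Reasoning
    instance
      u≢0 : NonZero u
      u≢0 = isPAdicUnit⇒nonZero p u isUnit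

  p∣↥⇒div : ∀ {x} → Integral x → p ℕ.∣ ℤ.∣ ↥ x ∣ → Divisible 1 x
  p∣↥⇒div {x} ix p∣↥ = div-cancel (unit-ι p∤↧) (subst (Divisible 1) (trans (sym (q*↧≡↥ x)) (*-comm x _)) (p∣⇒div (↥ x) p∣↥))
    where
    p∤↧ : ¬ p ℕ.∣ ↧ₙ x
    p∤↧ = integral⇒isPIntegral ix
    p∣ℕ⇒div : ∀ n → p ℕ.∣ n → Divisible 1 (ℕ→ℚ n)
    p∣ℕ⇒div n (ℕ.divides q n≡qp) = mkDivisible (ℕ→ℚ q) (integral-ι q)
      (trans (cong ℕ→ℚ (trans n≡qp (trans (ℕ.*-comm q p) (cong (ℕ._* q) (sym (ℕ.*-identityʳ p)))))) (ι-* (p ℕ.* 1) q))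
    p∣⇒div : ∀ n → p ℕ.∣ ℤ.∣ n ∣ → Divisible 1 (ℤ→ℚ n)
    p∣⇒div (+ n)       h = p∣ℕ⇒div n h
    p∣⇒div ℤ.-[1+ m ] h = subst (Divisible 1) (sym (ℤ→ℚ-neg (+ suc m))) (div-neg (p∣ℕ⇒div (suc m) h))

  unit⇒isPAdicUnit : ∀ {u} → Unit u → IsPAdicUnit p u
  unit⇒isPAdicUnit U = (λ p∣↥ → unit⇒¬div U (p∣↥⇒div (integral U) p∣↥)) , integral⇒isPIntegral (integral U)

  -- Whether an integral element is a unit depends on its residue modulo p: if p divided the
  -- numerator of v, it would divide u.
  unit-≈ : ∀ {u v} → Unit u → Integral v → u ≈ v [ 1 ] → Unit v
  unit-≈ {u} {v} U iv h = isPAdicUnit⇒unit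
    ( (λ p∣↥ → unit⇒¬div U (≈0⇒div (≈-trans h (div⇒≈0 (p∣↥⇒div iv p∣↥)))))
    , integral⇒isPIntegral iv)

  -- Integer approximations modulo powers of p

  p∤⇒coprime : ∀ {n} → ¬ p ℕ.∣ n → Coprimality.Coprime p n
  p∤⇒coprime {n} p∤n {d} (d∣p , d∣n) with prime⇒irreducible pr d∣p
  ... | inj₁ d≡1  = d≡1
  ... | inj₂ refl = contradiction d∣n p∤n

  x*p≡p^1*x : ∀ x → x ℕ.* p ≡ p ℕ.^ 1 ℕ.* x
  x*p≡p^1*x x = trans (ℕ.*-comm x p) (cong (ℕ._* x) (sym (ℕ.*-identityʳ p)))

  n+p^1*0≡n : ∀ n → n ℕ.+ p ℕ.^ 1 ℕ.* 0 ≡ n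
  n+p^1*0≡n n = trans (cong (n ℕ.+_) (ℕ.*-zeroʳ (p ℕ.^ 1))) (ℕ.+-identityʳ n)

  inverse-mod-p-ℕ : ∀ n → ¬ p ℕ.∣ n → ∃[ y ] ℕ→ℚ n * ℤ→ℚ y ≈ 1ℚ [ 1 ]
  inverse-mod-p-ℕ n p∤n with Coprimality.coprime-Bézout (p∤⇒coprime p∤n)
  ... | Bézout.-+ x y eq = + y , ≈-trans (≈-reflexive (sym (ι-* n y)))
        (≈-ι 1 {n ℕ.* y} {1} 0 x (trans (n+p^1*0≡n _) (trans (ℕ.*-comm n y) (trans (sym eq) (cong suc (x*p≡p^1*x x))))))
  -- In this case 1 + y n = x p, so the inverse is - y.
  ... | Bézout.+- x y eq = ℤ.- (+ y) , mk≈ (subst (Divisible 1) (sym diff) (div-neg (mkDivisible (ℕ→ℚ x) (integral-ι x) px)))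
    where
    lemma : ∀ n y → n * - y - 1ℚ ≡ - (1ℚ + y * n)
    lemma = solve-∀ ℚ-ring
    diff : ℕ→ℚ n * ℤ→ℚ (ℤ.- (+ y)) - 1ℚ ≡ - (1ℚ + ℕ→ℚ y * ℕ→ℚ n)
    diff = trans (cong (λ z → ℕ→ℚ n * z - 1ℚ) (ℤ→ℚ-neg (+ y))) (lemma (ℕ→ℚ n) (ℕ→ℚ y))
    open ≡-Reasoning
    px : 1ℚ + ℕ→ℚ y * ℕ→ℚ n ≡ ℕ→ℚ (p ℕ.^ 1) * ℕ→ℚ x
    px = begin
      1ℚ + ℕ→ℚ y * ℕ→ℚ n              ≡⟨ cong (λ z → 1ℚ + z) (ι-* y n) ⟨
      1ℚ + ℕ→ℚ (y ℕ.* n)              ≡⟨ ι-+ 1 (y ℕ.* n) ⟨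
      ℕ→ℚ (1 ℕ.+ y ℕ.* n)             ≡⟨ cong ℕ→ℚ (trans eq (x*p≡p^1*x x)) ⟩
      ℕ→ℚ (p ℕ.^ 1 ℕ.* x)             ≡⟨ ι-* (p ℕ.^ 1) x ⟩
      ℕ→ℚ (p ℕ.^ 1) * ℕ→ℚ x           ∎

  inverse-mod-p : ∀ n → ¬ p ℕ.∣ ℤ.∣ n ∣ → ∃[ y ] ℤ→ℚ n * ℤ→ℚ y ≈ 1ℚ [ 1 ]
  inverse-mod-p (+ n)      p∤n = inverse-mod-p-ℕ n p∤n
  inverse-mod-p ℤ.-[1+ m ] p∤n with inverse-mod-p-ℕ (suc m) p∤n
  ... | y , h = ℤ.- y , ≈-trans (≈-reflexive (trans (cong₂ _*_ (ℤ→ℚ-neg (+ suc m)) (ℤ→ℚ-neg y)) (lemma (ℕ→ℚ (suc m)) (ℤ→ℚ y)))) h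
    where
    lemma : ∀ a b → - a * - b ≡ a * b
    lemma = solve-∀ ℚ-ring

  -- The residue field of the localization is ℤ / p: dividing by the denominator becomes multiplying
  -- by an integer inverse modulo p.
  approximate-mod-p : ∀ {x} → Integral x → ∃[ n ] x ≈ ℤ→ℚ n [ 1 ]
  approximate-mod-p {x} ix@(mkIntegral b a p∤b xb) with inverse-mod-p b p∤b
  ... | y , h = a ℤ.* y , ≈-sym (≈-trans (≈-reflexive (begin
      ℤ→ℚ (a ℤ.* y)              ≡⟨ ℤ→ℚ-* a y ⟩
      ℤ→ℚ a * ℤ→ℚ y              ≡⟨ cong (_* ℤ→ℚ y) xb ⟨
      x * ℤ→ℚ b * ℤ→ℚ y          ≡⟨ *-assoc x (ℤ→ℚ b) (ℤ→ℚ y) ⟩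
      x * (ℤ→ℚ b * ℤ→ℚ y)        ∎)) (≈-trans (≈-*ˡ ix h) (≈-reflexive (*-identityʳ x))))
    where open ≡-Reasoning

  refine-approximation : ∀ k {x n m r} → x - ℤ→ℚ n ≡ ℕ→ℚ (p ℕ.^ k) * r → r ≈ ℤ→ℚ m [ 1 ] →
                         x ≈ ℤ→ℚ (n ℤ.+ + (p ℕ.^ k) ℤ.* m) [ suc k ]
  refine-approximation k {x} {n} {m} {r} eq (mk≈ h) = mk≈ (subst (Divisible (suc k)) (sym diff)
    (subst (λ j → Divisible j (P * (r - ℤ→ℚ m))) (ℕ.+-comm k 1) (div-* (div-p^ k) h)))
    where
    P = ℕ→ℚ (p ℕ.^ k)
    lemma₁ : ∀ x n P m → x - (n + P * m) ≡ (x - n) - P * m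
    lemma₁ = solve-∀ ℚ-ring
    lemma₂ : ∀ P r m → P * r - P * m ≡ P * (r - m)
    lemma₂ = solve-∀ ℚ-ring
    open ≡-Reasoning
    diff : x - ℤ→ℚ (n ℤ.+ + (p ℕ.^ k) ℤ.* m) ≡ P * (r - ℤ→ℚ m)
    diff = begin
      x - ℤ→ℚ (n ℤ.+ + (p ℕ.^ k) ℤ.* m)          ≡⟨ cong (λ z → x - z) (ℤ→ℚ-+ n (+ (p ℕ.^ k) ℤ.* m)) ⟩
      x - (ℤ→ℚ n + ℤ→ℚ (+ (p ℕ.^ k) ℤ.* m))      ≡⟨ cong (λ z → x - (ℤ→ℚ n + z)) (ℤ→ℚ-* (+ (p ℕ.^ k)) m) ⟩
      x - (ℤ→ℚ n + P * ℤ→ℚ m)                    ≡⟨ lemma₁ x (ℤ→ℚ n) P (ℤ→ℚ m) ⟩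
      (x - ℤ→ℚ n) - P * ℤ→ℚ m                    ≡⟨ cong (_- P * ℤ→ℚ m) eq ⟩
      P * r - P * ℤ→ℚ m                          ≡⟨ lemma₂ P r (ℤ→ℚ m) ⟩
      P * (r - ℤ→ℚ m)                            ∎

  -- Supplies the integer residues from which an element of `ℤₚ` is built: the cofactor of the error
  -- modulo p ^ k, itself approximated modulo p, gives the next correction.
  approximate : ∀ {x} k → Integral x → ∃[ n ] x ≈ ℤ→ℚ n [ k ]
  approximate zero    ix = + 0 , div⇒≈0 (integral⇒div ix)
  approximate (suc k) ix =
    let n , mk≈ (mkDivisible r ir eq) = approximate k ix
        m , h = approximate-mod-p ir
    in n ℤ.+ + (p ℕ.^ k) ℤ.* m , refine-approximation k {n = n} {m} eq h

  p^∣-cancel : ∀ k {m b} → ¬ p ℕ.∣ b → p ℕ.^ k ℕ.∣ m ℕ.* b → p ℕ.^ k ℕ.∣ m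
  p^∣-cancel k {m} {b} p∤b h = Coprimality.coprime-divisor (coprime-^ k) (subst (p ℕ.^ k ℕ.∣_) (ℕ.*-comm m b) h)
    where
    coprime-^ : ∀ k → Coprimality.Coprime (p ℕ.^ k) b
    coprime-^ zero    = Coprimality.1-coprimeTo b
    coprime-^ (suc k) {d} (d∣ , d∣b) = coprime-^ k (Coprimality.coprime-divisor coprime-d-p d∣ , d∣b)
      where
      coprime-d-p : Coprimality.Coprime d p
      coprime-d-p (e∣d , e∣p) = p∤⇒coprime p∤b (e∣p , ℕ.∣-trans e∣d d∣b)

  -- A denominator prime to p can be cancelled from a divisibility by p ^ k. This passes from the
  -- localization to ℤ, where coherence in `ℤₚ` is stated.
  div⇒ℤ∣ : ∀ k n → Divisible k (ℤ→ℚ n) → (+ (p ℕ.^ k)) ℤ.∣ n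
  div⇒ℤ∣ k n (mkDivisible r (mkIntegral b m p∤b rb) eq) =
    p^∣-cancel k p∤b (subst (p ℕ.^ k ℕ.∣_) (trans (sym (ℤ.abs-* (+ (p ℕ.^ k)) m)) (trans (cong ℤ.∣_∣ (sym nb)) (ℤ.abs-* n b))) (ℕ.m∣m*n ℤ.∣ m ∣))
    where
    open ≡-Reasoning
    nb : n ℤ.* b ≡ + (p ℕ.^ k) ℤ.* m
    nb = ℤ→ℚ-injective (begin
      ℤ→ℚ (n ℤ.* b)                         ≡⟨ ℤ→ℚ-* n b ⟩
      ℤ→ℚ n * ℤ→ℚ b                         ≡⟨ cong (_* ℤ→ℚ b) eq ⟩
      ℕ→ℚ (p ℕ.^ k) * r * ℤ→ℚ b             ≡⟨ *-assoc (ℕ→ℚ (p ℕ.^ k)) r (ℤ→ℚ b) ⟩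
      ℕ→ℚ (p ℕ.^ k) * (r * ℤ→ℚ b)           ≡⟨ cong (ℕ→ℚ (p ℕ.^ k) *_) rb ⟩
      ℕ→ℚ (p ℕ.^ k) * ℤ→ℚ m                 ≡⟨ ℤ→ℚ-* (+ (p ℕ.^ k)) m ⟨
      ℤ→ℚ (+ (p ℕ.^ k) ℤ.* m)               ∎)

-- The transfer operator and Dwork's congruences

module Transfer (p : ℕ) (pr : Prime p) (w : ℕ → ℕ → ℚ) where
  open Localization p pr

  L : (ℕ → ℚ) → ℕ → ℚ
  L φ x = Σ< p λ b → w b x * φ (b ℕ.+ p ℕ.* x)

  Values : ℕ → (ℕ → ℚ) → Set
  Values k φ = ∀ x → Divisible k (φ x)

  -- Equivalently, φ - φ 0 is p ^ k times an integral function with p-adic Lipschitz constant 1. The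
  -- case j = 0 contains constancy modulo p ^ k.
  Lipschitz : ℕ → (ℕ → ℚ) → Set
  Lipschitz k φ = ∀ j x → φ (x ℕ.+ p ℕ.^ j) ≈ φ x [ k ℕ.+ j ]

  lipschitz⇒≈φ0 : ∀ {k φ} → Lipschitz k φ → ∀ x → φ x ≈ φ 0 [ k ]
  lipschitz⇒≈φ0         lip zero    = ≈-refl
  lipschitz⇒≈φ0 {k} {φ} lip (suc x) = ≈-trans
    (subst (λ y → φ y ≈ φ x [ k ]) (ℕ.+-comm x 1) (subst (λ i → φ (x ℕ.+ 1) ≈ φ x [ i ]) (ℕ.+-identityʳ k) (lip 0 x)))
    (lipschitz⇒≈φ0 {k} {φ} lip x)

  lipschitz⇒values : ∀ {k φ} → Lipschitz k φ → φ 0 ≡ 0ℚ → Values k φ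
  lipschitz⇒values {k} {φ} lip φ0 x = ≈0⇒div (≈-trans (lipschitz⇒≈φ0 {k} {φ} lip x) (≈-reflexive φ0))

  lipschitz-resp : ∀ {k φ ψ} → (∀ x → φ x ≡ ψ x) → Lipschitz k φ → Lipschitz k ψ
  lipschitz-resp eq lip j x = ≈-trans (≈-reflexive (sym (eq _))) (≈-trans (lip j x) (≈-reflexive (eq x)))

  lipschitz-weaken : ∀ {k φ} → Lipschitz (suc k) φ → Lipschitz k φ
  lipschitz-weaken lip j x = ≈-weaken (ℕ.n≤1+n _) (lip j x)

  lipschitz-* : ∀ {k i c φ} → Divisible k c → Lipschitz i φ → Lipschitz (k ℕ.+ i) (λ x → c * φ x)
  lipschitz-* {k} {i} {c} {φ} hc lip j x =
    mk≈ (subst (λ n → Divisible n (c * φ (x ℕ.+ p ℕ.^ j) - c * φ x)) (sym (ℕ.+-assoc k i j))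
      (subst (Divisible (k ℕ.+ (i ℕ.+ j))) (lemma c (φ (x ℕ.+ p ℕ.^ j)) (φ x)) (div-* hc (difference (lip j x)))))
    where
    lemma : ∀ c u v → c * (u - v) ≡ c * u - c * v
    lemma = solve-∀ ℚ-ring

  lipschitz-- : ∀ {k φ ψ} → Lipschitz k φ → Lipschitz k ψ → Lipschitz k (λ x → φ x - ψ x)
  lipschitz-- {k} {φ} {ψ} f g j x = mk≈ (subst (Divisible (k ℕ.+ j)) (lemma (φ (x ℕ.+ p ℕ.^ j)) (φ x) (ψ (x ℕ.+ p ℕ.^ j)) (ψ x))
      (div-+ (difference (f j x)) (div-neg (difference (g j x)))))
    where
    lemma : ∀ u v u′ v′ → (u - v) + (- (u′ - v′)) ≡ (u - u′) - (v - v′)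
    lemma = solve-∀ ℚ-ring

  L-linear : ∀ φ ψ c c′ x → L (λ y → φ y * c - ψ y * c′) x ≡ L φ x * c - L ψ x * c′
  L-linear φ ψ c c′ x = begin
    Σ< p (λ b → w b x * (φ (b ℕ.+ p ℕ.* x) * c - ψ (b ℕ.+ p ℕ.* x) * c′))
      ≡⟨ Σ-cong p (λ b _ → lemma₁ (w b x) (φ (b ℕ.+ p ℕ.* x)) c (ψ (b ℕ.+ p ℕ.* x)) c′) ⟩
    Σ< p (λ b → c * (w b x * φ (b ℕ.+ p ℕ.* x)) + - c′ * (w b x * ψ (b ℕ.+ p ℕ.* x)))
      ≡⟨ Σ-+ p (λ b → c * (w b x * φ (b ℕ.+ p ℕ.* x))) (λ b → - c′ * (w b x * ψ (b ℕ.+ p ℕ.* x))) ⟩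
    Σ< p (λ b → c * (w b x * φ (b ℕ.+ p ℕ.* x))) + Σ< p (λ b → - c′ * (w b x * ψ (b ℕ.+ p ℕ.* x)))
      ≡⟨ cong₂ _+_ (*-Σ c p (λ b → w b x * φ (b ℕ.+ p ℕ.* x))) (*-Σ (- c′) p (λ b → w b x * ψ (b ℕ.+ p ℕ.* x))) ⟩
    c * L φ x + - c′ * L ψ x
      ≡⟨ lemma₂ c c′ (L φ x) (L ψ x) ⟩
    L φ x * c - L ψ x * c′ ∎
    where
    open ≡-Reasoning
    lemma₁ : ∀ w u c v c′ → w * (u * c - v * c′) ≡ c * (w * u) + - c′ * (w * v)
    lemma₁ = solve-∀ ℚ-ring
    lemma₂ : ∀ c c′ u v → c * u + - c′ * v ≡ u * c - v * c′
    lemma₂ = solve-∀ ℚ-ring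

  Φ : ℕ → ℕ → ℚ
  Φ zero    x = 1ℚ
  Φ (suc s) x = L (Φ s) x

  T : ℕ → ℚ
  T s = Φ s 0

  module _ (w-integral  : ∀ b x → b ℕ.< p → Integral (w b x))
           (w-lipschitz : ∀ b → b ℕ.< p → Lipschitz 1 (w b)) where

    L-values : ∀ {k φ} → Values k φ → Values k (L φ)
    L-values {k} {φ} vals x = div-Σ p λ b b<p → div-*ˡ (w-integral b x b<p) (vals (b ℕ.+ p ℕ.* x))

    -- The gain of a factor p has two sources: the weights change by a multiple of p ^ (j + 1),
    -- which meets a value divisible by p ^ k; and the argument b + p x moves by p ^ (j + 1) when x
    -- moves by p ^ j.
    L-lipschitz : ∀ {k φ} → Values k φ → Lipschitz k φ → Lipschitz (suc k) (L φ)
    L-lipschitz {k} {φ} vals lip j x = ≈-Σ p term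
      where
      term : ∀ b → b ℕ.< p →
        w b (x ℕ.+ p ℕ.^ j) * φ (b ℕ.+ p ℕ.* (x ℕ.+ p ℕ.^ j)) ≈ w b x * φ (b ℕ.+ p ℕ.* x) [ suc k ℕ.+ j ]
      term b b<p = mk≈ (subst (Divisible (suc k ℕ.+ j)) (lemma w′ (w b x) φ′ (φ y))
          (div-+ (subst (λ n → Divisible (suc n) ((w′ - w b x) * φ′)) (ℕ.+-comm j k)
                   (div-* (difference (w-lipschitz b b<p j x)) (vals (b ℕ.+ p ℕ.* (x ℕ.+ p ℕ.^ j)))))
                 (div-*ˡ (w-integral b x b<p) (difference φ≈))))
        where
        y = b ℕ.+ p ℕ.* x
        w′ = w b (x ℕ.+ p ℕ.^ j)
        φ′ = φ (b ℕ.+ p ℕ.* (x ℕ.+ p ℕ.^ j))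
        shift : y ℕ.+ p ℕ.^ suc j ≡ b ℕ.+ p ℕ.* (x ℕ.+ p ℕ.^ j)
        shift = trans (ℕ.+-assoc b (p ℕ.* x) _) (cong (b ℕ.+_) (sym (ℕ.*-distribˡ-+ p x (p ℕ.^ j))))
        φ≈ : φ′ ≈ φ y [ suc k ℕ.+ j ]
        φ≈ = subst (λ n → φ′ ≈ φ y [ n ]) (ℕ.+-suc k j) (subst (λ n → φ n ≈ φ y [ k ℕ.+ suc j ]) shift (lip (suc j) y))
        lemma : ∀ w′ w φ′ φ → (w′ - w) * φ′ + w * (φ′ - φ) ≡ w′ * φ′ - w * φ
        lemma = solve-∀ ℚ-ring

    Φ-values : ∀ s → Values 0 (Φ s)
    Φ-values zero    x = integral⇒div integral-1
    Φ-values (suc s) = L-values {0} {Φ s} (Φ-values s)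

    Φ-lipschitz : ∀ s → Lipschitz 1 (Φ s)
    Φ-lipschitz zero    j x = ≈-refl
    Φ-lipschitz (suc s) = L-lipschitz {0} {Φ s} (Φ-values s) (lipschitz-weaken {0} {Φ s} (Φ-lipschitz s))

    T-integral : ∀ s → Integral (T s)
    T-integral s = div⇒integral (Φ-values s 0)

    -- Modulo p the function `Φ s` is the constant `T s`, which can be pulled out of `L`. By
    -- induction every `T s` is then a unit once `T 1` is.
    T-multiplicative : ∀ s → T s * T 1 ≈ T (suc s) [ 1 ]
    T-multiplicative s = ≈-trans
      (≈-reflexive (sym (*-Σ (T s) p (λ b → w b 0 * 1ℚ))))
      (≈-Σ p λ b b<p → ≈-trans (≈-reflexive (lemma (T s) (w b 0)))
        (≈-*ˡ (w-integral b 0 b<p) (≈-sym (lipschitz⇒≈φ0 {1} {Φ s} (Φ-lipschitz s) (b ℕ.+ p ℕ.* 0)))))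
      where
      lemma : ∀ t w → t * (w * 1ℚ) ≡ w * t
      lemma = solve-∀ ℚ-ring

    T-unit : Unit (T 1) → ∀ s → Unit (T s)
    T-unit u zero    = unit-1
    T-unit u (suc s) = unit-≈ (unit-* (T-unit u s) u) (T-integral (suc s)) (T-multiplicative s)

    -- The difference of the normalised iterates Φ (s + 1) / T (s + 1) and Φ s / T s with
    -- denominators cleared; the normalisation makes it vanish at 0.
    E : ℕ → ℕ → ℚ
    E s x = Φ (suc s) x * T s - Φ s x * T (suc s)

    E0≡0 : ∀ s → E s 0 ≡ 0ℚ
    E0≡0 s = lemma (T (suc s)) (T s)
      where
      lemma : ∀ u v → u * v - v * u ≡ 0ℚ
      lemma = solve-∀ ℚ-ring

    LE≡ : ∀ s x → L (E s) x ≡ Φ (suc (suc s)) x * T s - Φ (suc s) x * T (suc s)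
    LE≡ s x = L-linear (Φ (suc s)) (Φ s) (T s) (T (suc s)) x

    module _ (T₁-unit : Unit (T 1)) where

      -- Induction through T s · E (s + 1) = T (s + 1) · L (E s) - L (E s) 0 · Φ (s + 1). As `E s`
      -- vanishes at 0, its values are divisible by p ^ (s + 1), so `L` improves its Lipschitz
      -- exponent by one. In the second term the constant contributes p ^ (s + 1) and `Φ (suc s)`
      -- one more factor p. The unit `T s` is then cancelled.
      E-lipschitz : ∀ s → Lipschitz (suc s) (E s)
      LE-values   : ∀ s → Values (suc s) (L (E s))

      LE-values s = L-values {suc s} {E s} (lipschitz⇒values {suc s} {E s} (E-lipschitz s) (E0≡0 s))

      E-lipschitz zero = lipschitz-resp {1} {λ x → 1ℚ * Φ 1 x - T 1 * 1ℚ} (λ x → lemma (Φ 1 x) (T 1))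
        (lipschitz-- {1} {λ x → 1ℚ * Φ 1 x} {λ x → T 1 * 1ℚ}
          (lipschitz-* {0} {1} {1ℚ} {Φ 1} (integral⇒div integral-1) (Φ-lipschitz 1)) (λ j x → ≈-refl))
        where
        lemma : ∀ u v → 1ℚ * u - v * 1ℚ ≡ u * 1ℚ - 1ℚ * v
        lemma = solve-∀ ℚ-ring
      E-lipschitz (suc s) j x = ≈-cancel (T-unit T₁-unit s) (scaled j x)
        where
        LE = L (E s)
        combination : ℕ → ℚ
        combination y = T (suc s) * LE y - LE 0 * Φ (suc s) y
        lemma : ∀ t₀ t₁ t₂ u v → t₁ * (u * t₀ - v * t₁) - (t₂ * t₀ - t₁ * t₁) * v ≡ t₀ * (u * t₁ - v * t₂)
        lemma = solve-∀ ℚ-ring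
        combination≡ : ∀ y → combination y ≡ T s * E (suc s) y
        combination≡ y = trans (cong₂ (λ a b → T (suc s) * a - b * Φ (suc s) y) (LE≡ s y) (LE≡ s 0))
          (lemma (T s) (T (suc s)) (T (suc (suc s))) (Φ (suc (suc s)) y) (Φ (suc s) y))
        first : Lipschitz (suc (suc s)) (λ y → T (suc s) * LE y)
        first = lipschitz-* {0} {suc (suc s)} {T (suc s)} {LE} (integral⇒div (T-integral (suc s)))
          (L-lipschitz {suc s} {E s} (lipschitz⇒values {suc s} {E s} (E-lipschitz s) (E0≡0 s)) (E-lipschitz s))
        second : Lipschitz (suc (suc s)) (λ y → LE 0 * Φ (suc s) y)
        second = subst (λ n → Lipschitz n (λ y → LE 0 * Φ (suc s) y)) (ℕ.+-comm (suc s) 1)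
          (lipschitz-* {suc s} {1} {LE 0} {Φ (suc s)} (LE-values s 0) (Φ-lipschitz (suc s)))
        scaled : Lipschitz (suc (suc s)) (λ y → T s * E (suc s) y)
        scaled = lipschitz-resp {suc (suc s)} {combination} combination≡
          (lipschitz-- {suc (suc s)} {λ y → T (suc s) * LE y} {λ y → LE 0 * Φ (suc s) y} first second)

      module _ (q : ℕ → ℚ) (q*T : ∀ s → q s * T s ≡ T (suc s)) where

        -- The difference of the quotients times T s · T (s + 1) is T (s + 2) · T s - T (s + 1)²,
        -- which is the value of `L (E s)` at 0.
        quotients-≈ : ∀ {k} s → Divisible k (L (E s) 0) → q (suc s) ≈ q s [ k ]
        quotients-≈ {k} s h = mk≈ (div-cancel (unit-* (T-unit T₁-unit s) (T-unit T₁-unit (suc s)))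
          (subst (Divisible k) (sym eq) h))
          where
          lemma : ∀ t₀ t₁ q₁ q₀ → t₀ * t₁ * (q₁ - q₀) ≡ (q₁ * t₁) * t₀ - (q₀ * t₀) * t₁
          lemma = solve-∀ ℚ-ring
          eq : T s * T (suc s) * (q (suc s) - q s) ≡ L (E s) 0
          eq = trans (lemma (T s) (T (suc s)) (q (suc s)) (q s))
            (trans (cong₂ (λ a b → a * T s - b * T (suc s)) (q*T (suc s)) (q*T s)) (sym (LE≡ s 0)))

        dwork-congruence : ∀ s → q (suc s) ≈ q s [ suc s ]
        dwork-congruence s = quotients-≈ s (LE-values s 0)

        -- `dwork-congruence` gives a single power of p at s = 0. Since `T 0` is 1, `E 0` is Φ 1 - T
        -- 1, so constancy of `Φ 1` modulo p² makes its values divisible by p², and `L` preserves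
        -- this.
        first-quotients-≈-mod-p² : (∀ x → Φ 1 x ≈ Φ 1 0 [ 2 ]) → q 1 ≈ q 0 [ 2 ]
        first-quotients-≈-mod-p² h = quotients-≈ 0 (L-values {2} {E 0} E0-values 0)
          where
          lemma : ∀ u v → u - v ≡ u * 1ℚ - 1ℚ * v
          lemma = solve-∀ ℚ-ring
          E0-values : Values 2 (E 0)
          E0-values x = subst (Divisible 2) (lemma (Φ 1 x) (T 1)) (difference (h x))

-- Ratios of consecutive coefficients, and signs

-- e (2j) is the ratio of consecutive coefficients α (j + 1) / α j.
e ē t : ℕ → ℚ
e n = frac (1 ℕ.+ n) (2 ℕ.+ n)
ē n = frac (2 ℕ.+ n) (1 ℕ.+ n)
t n = e (2 ℕ.* n)

e*ē : ∀ n → e n * ē n ≡ 1ℚ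
e*ē n = trans (lemma (ℕ→ℚ (1 ℕ.+ n)) (invℕ (2 ℕ.+ n)) (ℕ→ℚ (2 ℕ.+ n)) (invℕ (1 ℕ.+ n)))
  (cong₂ _*_ (ι*invℕ (1 ℕ.+ n)) (ι*invℕ (2 ℕ.+ n)))
  where
  lemma : ∀ a b c d → a * b * (c * d) ≡ a * d * (c * b)
  lemma = solve-∀ ℚ-ring

α-suc : ∀ n → α (suc n) ≡ α n * t n
α-suc n = begin
  pochhammer ½ (suc n) * ((+ 1) / (suc n !)) {{suc n !≢0}}
    ≡⟨ cong₂ _*_ (trans (product≡Π (suc n) factor) (Π-last n factor)) (trans (1/≡invℕ (suc n !) {{suc n !≢0}}) (invℕ-* (suc n) (n !))) ⟩
  (Π< n factor * factor n) * (invℕ (suc n) * invℕ (n !))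
    ≡⟨ lemma₁ (Π< n factor) (factor n) (invℕ (suc n)) (invℕ (n !)) ⟩
  (Π< n factor * invℕ (n !)) * (factor n * invℕ (suc n))
    ≡⟨ cong₂ _*_ (cong₂ _*_ (product≡Π n factor) (1/≡invℕ (n !) {{n !≢0}})) ratio ⟨
  α n * t n ∎
  where
  open ≡-Reasoning
  factor : ℕ → ℚ
  factor i = ½ + ℕ→ℚ i
  1/≡invℕ : ∀ k .{{_ : ℕ.NonZero k}} → + 1 / k ≡ invℕ k
  1/≡invℕ (suc k) = refl
  lemma₁ : ∀ P f i j → (P * f) * (i * j) ≡ (P * j) * (f * i)
  lemma₁ = solve-∀ ℚ-ring
  lemma₂ : ∀ x y → (1ℚ + ℕ→ℚ 2 * x) * (½ * y) ≡ (½ + x) * y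
  lemma₂ = solve-∀ ℚ-ring
  2+2n : ∀ n → 2 ℕ.+ 2 ℕ.* n ≡ 2 ℕ.* suc n
  2+2n = ℕSolver.solve-∀
  ratio : t n ≡ factor n * invℕ (suc n)
  ratio = begin
    ℕ→ℚ (1 ℕ.+ 2 ℕ.* n) * invℕ (2 ℕ.+ 2 ℕ.* n)
      ≡⟨ cong₂ _*_ (trans (ι-+ 1 (2 ℕ.* n)) (cong (λ x → 1ℚ + x) (ι-* 2 n))) (trans (cong invℕ (2+2n n)) (invℕ-* 2 (suc n))) ⟩
    (1ℚ + ℕ→ℚ 2 * ℕ→ℚ n) * (½ * invℕ (suc n))
      ≡⟨ lemma₂ (ℕ→ℚ n) (invℕ (suc n)) ⟩
    factor n * invℕ (suc n) ∎

α≡Π : ∀ n → α n ≡ Π< n t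
α≡Π zero    = refl
α≡Π (suc n) = trans (α-suc n) (trans (cong (_* t n) (α≡Π n)) (sym (Π-last n t)))

Π-1 : ∀ n {f} → (∀ i → f i ≡ 1ℚ) → Π< n f ≡ 1ℚ
Π-1 zero    h = refl
Π-1 (suc n) h = trans (cong₂ _*_ (h 0) (Π-1 n λ i → h (suc i))) (*-identityˡ 1ℚ)

Π-neg : ∀ n g → Π< n (λ i → - g i) ≡ (- 1ℚ) ^ n * Π< n g
Π-neg zero    g = refl
Π-neg (suc n) g = trans (cong (- g 0 *_) (Π-neg n (λ i → g (suc i)))) (lemma (g 0) ((- 1ℚ) ^ n) (Π< n (λ i → g (suc i))))
  where
  lemma : ∀ a s P → - a * (s * P) ≡ - 1ℚ * s * (a * P)
  lemma = solve-∀ ℚ-ring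

square≡1⇒^≡1 : ∀ {x} → x * x ≡ 1ℚ → ∀ n → x ^ (n ℕ.+ n) ≡ 1ℚ
square≡1⇒^≡1 {x} x²≡1 n = begin
  x ^ (n ℕ.+ n)       ≡⟨ ^-homo-* x n n ⟩
  x ^ n * x ^ n       ≡⟨ ^-distrib-* x x n ⟨
  (x * x) ^ n         ≡⟨ cong (_^ n) x²≡1 ⟩
  1ℚ ^ n              ≡⟨ 1^n≡1 n ⟩
  1ℚ                  ∎
  where open ≡-Reasoning

[-1]^n[1+n]≡1 : ∀ n → (- 1ℚ) ^ (n ℕ.* suc n) ≡ 1ℚ
[-1]^n[1+n]≡1 zero    = refl
[-1]^n[1+n]≡1 (suc n) = begin
  s ^ (suc n ℕ.* suc (suc n))                       ≡⟨ cong (s ^_) (lemma n) ⟩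
  s ^ ((suc n ℕ.+ suc n) ℕ.+ n ℕ.* suc n)           ≡⟨ ^-homo-* s (suc n ℕ.+ suc n) (n ℕ.* suc n) ⟩
  s ^ (suc n ℕ.+ suc n) * s ^ (n ℕ.* suc n)         ≡⟨ cong₂ _*_ (square≡1⇒^≡1 refl (suc n)) ([-1]^n[1+n]≡1 n) ⟩
  1ℚ                                                ∎
  where
  open ≡-Reasoning
  s = - 1ℚ
  lemma : ∀ n → suc n ℕ.* suc (suc n) ≡ (suc n ℕ.+ suc n) ℕ.+ n ℕ.* suc n
  lemma = ℕSolver.solve-∀

-- The ratios α (b + p x) / α x for an odd prime p = 2 m + 1

module Coefficients (p m : ℕ) (pr : Prime p) (p≢2 : p ≢ 2) (p≡1+2m : p ≡ suc (m ℕ.+ m)) where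
  open Localization p pr

  instance
    p-nonZero : ℕ.NonZero p
    p-nonZero = prime⇒nonZero pr

  p∤2 : ¬ p ℕ.∣ 2
  p∤2 p∣2 = p≢2 (ℕ.≤-antisym (ℕ.∣⇒≤ p∣2) (ℕ.nonTrivial⇒n>1 p {{prime⇒nonTrivial pr}}))

  p∤py+r : ∀ y r .{{_ : ℕ.NonZero r}} → r ℕ.< p → ¬ p ℕ.∣ p ℕ.* y ℕ.+ r
  p∤py+r y r r<p p∣ = ℕ.>⇒∤ r<p (ℕ.∣m+n∣m⇒∣n p∣ (ℕ.m∣m*n y))

  2+2j<p : ∀ {j} → j ℕ.< m → 2 ℕ.+ 2 ℕ.* j ℕ.< p
  2+2j<p {j} j<m = subst₂ ℕ._<_ (eq j) (sym p≡1+2m) (s≤s (ℕ.+-mono-≤ j<m j<m))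
    where
    eq : ∀ j → suc j ℕ.+ suc j ≡ 2 ℕ.+ 2 ℕ.* j
    eq = ℕSolver.solve-∀

  m<p : m ℕ.< p
  m<p = subst (m ℕ.<_) (sym p≡1+2m) (s≤s (ℕ.m≤m+n m m))

  p∤1+py+2j : ∀ y {j} → j ℕ.< m → ¬ p ℕ.∣ 1 ℕ.+ (p ℕ.* y ℕ.+ 2 ℕ.* j)
  p∤1+py+2j y {j} j<m = subst (λ n → ¬ p ℕ.∣ n) (ℕ.+-suc (p ℕ.* y) (2 ℕ.* j))
    (p∤py+r y (1 ℕ.+ 2 ℕ.* j) (ℕ.<-trans (ℕ.n<1+n _) (2+2j<p j<m)))

  p∤2+py+2j : ∀ y {j} → j ℕ.< m → ¬ p ℕ.∣ 2 ℕ.+ (p ℕ.* y ℕ.+ 2 ℕ.* j)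
  p∤2+py+2j y {j} j<m = subst (λ n → ¬ p ℕ.∣ n) (trans (ℕ.+-suc (p ℕ.* y) _) (cong suc (ℕ.+-suc (p ℕ.* y) (2 ℕ.* j))))
    (p∤py+r y (2 ℕ.+ 2 ℕ.* j) (2+2j<p j<m))

  2[px+j] : ∀ x j → p ℕ.* (2 ℕ.* x) ℕ.+ 2 ℕ.* j ≡ 2 ℕ.* (p ℕ.* x ℕ.+ j)
  2[px+j] = lemma p
    where
    lemma : ∀ p x j → p ℕ.* (2 ℕ.* x) ℕ.+ 2 ℕ.* j ≡ 2 ℕ.* (p ℕ.* x ℕ.+ j)
    lemma = ℕSolver.solve-∀

  p∤2+2[px+j] : ∀ x {j} → suc j ℕ.< p → ¬ p ℕ.∣ 2 ℕ.+ 2 ℕ.* (p ℕ.* x ℕ.+ j)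
  p∤2+2[px+j] x {j} j<p = subst (λ n → ¬ p ℕ.∣ n) (eq (p ℕ.* x) j) (p∤* p∤2 (p∤py+r x (suc j) j<p))
    where
    eq : ∀ y j → 2 ℕ.* (y ℕ.+ suc j) ≡ 2 ℕ.+ 2 ℕ.* (y ℕ.+ j)
    eq = ℕSolver.solve-∀

  e-≈ : ∀ k {n n′} u → ¬ p ℕ.∣ 2 ℕ.+ n → ¬ p ℕ.∣ 2 ℕ.+ n′ → n′ ≡ n ℕ.+ p ℕ.^ k ℕ.* u → e n′ ≈ e n [ k ]
  e-≈ k {n} u p∤ p∤′ refl = ≈-frac {a = 1 ℕ.+ (n ℕ.+ p ℕ.^ k ℕ.* u)} {1 ℕ.+ n} p∤′ p∤ (shift 1) (shift 2)
    where
    lemma : ∀ i n P u → (i ℕ.+ (n ℕ.+ P ℕ.* u)) ℕ.+ P ℕ.* 0 ≡ (i ℕ.+ n) ℕ.+ P ℕ.* u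
    lemma = ℕSolver.solve-∀
    shift : ∀ i → ℕ→ℚ (i ℕ.+ (n ℕ.+ p ℕ.^ k ℕ.* u)) ≈ ℕ→ℚ (i ℕ.+ n) [ k ]
    shift i = ≈-ι k 0 u (lemma i n (p ℕ.^ k) u)

  -- The denominator is 2 (p x + j + 1), so j = p - 1 has to be excluded.
  t-integral : ∀ x {j} → suc j ℕ.< p → Integral (t (p ℕ.* x ℕ.+ j))
  t-integral x {j} j<p = integral-frac (1 ℕ.+ 2 ℕ.* (p ℕ.* x ℕ.+ j)) (p∤2+2[px+j] x j<p)

  t-unit : ∀ x {j} → j ℕ.< m → Unit (t (p ℕ.* x ℕ.+ j))
  t-unit x {j} j<m = subst (λ n → Unit (e n)) (2[px+j] x j) (unit-frac (p∤1+py+2j (2 ℕ.* x) j<m) (p∤2+py+2j (2 ℕ.* x) j<m))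

  t-lipschitz : ∀ {j} → suc j ℕ.< p → ∀ k x → t (p ℕ.* (x ℕ.+ p ℕ.^ k) ℕ.+ j) ≈ t (p ℕ.* x ℕ.+ j) [ suc k ]
  t-lipschitz {j} j<p k x = e-≈ (suc k) 2 (p∤2+2[px+j] x j<p) (p∤2+2[px+j] (x ℕ.+ p ℕ.^ k) j<p) (lemma p x (p ℕ.^ k) j)
    where
    lemma : ∀ p x N j → 2 ℕ.* (p ℕ.* (x ℕ.+ N) ℕ.+ j) ≡ 2 ℕ.* (p ℕ.* x ℕ.+ j) ℕ.+ p ℕ.* N ℕ.* 2
    lemma = ℕSolver.solve-∀

  -- α (p x + b) = τ b x · α (p x)
  τ : ℕ → ℕ → ℚ
  τ b x = Π< b λ j → t (p ℕ.* x ℕ.+ j)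

  τ-integral : ∀ b x → b ℕ.< p → Integral (τ b x)
  τ-integral b x b<p = integral-Π b λ j j<b → t-integral x (ℕ.≤-<-trans j<b b<p)

  τ-lipschitz : ∀ b → b ℕ.< p → ∀ k x → τ b (x ℕ.+ p ℕ.^ k) ≈ τ b x [ suc k ]
  τ-lipschitz b b<p k x = ≈-Π b (λ j j<b → t-integral (x ℕ.+ p ℕ.^ k) (ℕ.≤-<-trans j<b b<p))
    (λ j j<b → t-integral x (ℕ.≤-<-trans j<b b<p)) (λ j j<b → t-lipschitz (ℕ.≤-<-trans j<b b<p) k x)

  τ-suc : ∀ b x → τ (suc b) x ≡ τ b x * t (p ℕ.* x ℕ.+ b)
  τ-suc b x = Π-last b (λ j → t (p ℕ.* x ℕ.+ j))

  η η̄ : ℕ → ℚ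
  η y = Π< m λ j → e (p ℕ.* y ℕ.+ 2 ℕ.* j)
  η̄ y = Π< m λ j → ē (p ℕ.* y ℕ.+ 2 ℕ.* j)

  η*η̄ : ∀ y → η y * η̄ y ≡ 1ℚ
  η*η̄ y = trans (sym (Π-* m (λ j → e (p ℕ.* y ℕ.+ 2 ℕ.* j)) (λ j → ē (p ℕ.* y ℕ.+ 2 ℕ.* j))))
    (Π-1 m λ j → e*ē (p ℕ.* y ℕ.+ 2 ℕ.* j))

  e-unit : ∀ y j → j ℕ.< m → Unit (e (p ℕ.* y ℕ.+ 2 ℕ.* j))
  e-unit y j j<m = unit-frac (p∤1+py+2j y j<m) (p∤2+py+2j y j<m)

  η-unit : ∀ y → Unit (η y)
  η-unit y = unit-Π m (e-unit y)

  η̄-unit : ∀ y → Unit (η̄ y)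
  η̄-unit y = unit-Π m λ j j<m → unit-frac (p∤2+py+2j y j<m) (p∤1+py+2j y j<m)

  η-lipschitz : ∀ k y → η (y ℕ.+ p ℕ.^ k) ≈ η y [ suc k ]
  η-lipschitz k y = ≈-Π m (λ j j<m → integral (e-unit (y ℕ.+ p ℕ.^ k) j j<m)) (λ j j<m → integral (e-unit y j j<m))
    λ j j<m → e-≈ (suc k) 1 (p∤2+py+2j y j<m) (p∤2+py+2j (y ℕ.+ p ℕ.^ k) j<m) (lemma p y (p ℕ.^ k) j)
    where
    lemma : ∀ p y N j → p ℕ.* (y ℕ.+ N) ℕ.+ 2 ℕ.* j ≡ p ℕ.* y ℕ.+ 2 ℕ.* j ℕ.+ p ℕ.* N ℕ.* 1
    lemma = ℕSolver.solve-∀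

  τ-m : ∀ x → τ m x ≡ η (2 ℕ.* x)
  τ-m x = Π-cong m λ j _ → cong e (sym (2[px+j] x j))

  -- α (p x) = c x · α x
  κ c : ℕ → ℚ
  κ x = η (2 ℕ.* x) * η̄ (1 ℕ.+ 2 ℕ.* x)
  c x = Π< x κ

  c-suc : ∀ x → c (suc x) ≡ c x * κ x
  c-suc x = Π-last x κ

  c-unit : ∀ x → Unit (c x)
  c-unit x = unit-Π x λ i _ → unit-* (η-unit (2 ℕ.* i)) (η̄-unit (1 ℕ.+ 2 ℕ.* i))

  -- In a block of p consecutive ratios the multiples of p contribute t x.
  τ-p : ∀ x → τ p x ≡ κ x * t x
  τ-p x = begin
    τ p x                                                       ≡⟨ cong (λ n → Π< n f) p≡m+1+m ⟩
    Π< (m ℕ.+ suc m) f                                          ≡⟨ Π-split m (suc m) f ⟩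
    τ m x * Π< (suc m) (λ i → f (m ℕ.+ i))                      ≡⟨ cong₂ _*_ (τ-m x) upper ⟩
    η (2 ℕ.* x) * (η̄ (1 ℕ.+ 2 ℕ.* x) * t x)                     ≡⟨ *-assoc (η (2 ℕ.* x)) (η̄ (1 ℕ.+ 2 ℕ.* x)) (t x) ⟨
    κ x * t x                                                   ∎
    where
    open ≡-Reasoning
    f : ℕ → ℚ
    f j = t (p ℕ.* x ℕ.+ j)
    p≡m+1+m : p ≡ m ℕ.+ suc m
    p≡m+1+m = trans p≡1+2m (sym (ℕ.+-suc m m))
    y = p ℕ.* (1 ℕ.+ 2 ℕ.* x)
    a b : ℕ → ℚ
    a i = ℕ→ℚ (y ℕ.+ 2 ℕ.* i)
    b i = invℕ (1 ℕ.+ (y ℕ.+ 2 ℕ.* i))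
    odd : ∀ p m → p ≡ suc (m ℕ.+ m) → ∀ x i → 1 ℕ.+ 2 ℕ.* (p ℕ.* x ℕ.+ (m ℕ.+ i)) ≡ p ℕ.* (1 ℕ.+ 2 ℕ.* x) ℕ.+ 2 ℕ.* i
    odd _ m refl x i = lemma m x i
      where
      lemma : ∀ m x i → 1 ℕ.+ 2 ℕ.* (suc (m ℕ.+ m) ℕ.* x ℕ.+ (m ℕ.+ i)) ≡ suc (m ℕ.+ m) ℕ.* (1 ℕ.+ 2 ℕ.* x) ℕ.+ 2 ℕ.* i
      lemma = ℕSolver.solve-∀
    top : ∀ p m → p ≡ suc (m ℕ.+ m) → ∀ x → 1 ℕ.+ (p ℕ.* (1 ℕ.+ 2 ℕ.* x) ℕ.+ 2 ℕ.* m) ≡ p ℕ.* (2 ℕ.+ 2 ℕ.* x)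
    top _ m refl x = lemma m x
      where
      lemma : ∀ m x → 1 ℕ.+ (suc (m ℕ.+ m) ℕ.* (1 ℕ.+ 2 ℕ.* x) ℕ.+ 2 ℕ.* m) ≡ suc (m ℕ.+ m) ℕ.* (2 ℕ.+ 2 ℕ.* x)
      lemma = ℕSolver.solve-∀
    next : ∀ y i → y ℕ.+ 2 ℕ.* suc i ≡ 2 ℕ.+ (y ℕ.+ 2 ℕ.* i)
    next = ℕSolver.solve-∀
    rearrange : ∀ u v w z → (u * v) * (w * z) ≡ (v * w) * (u * z)
    rearrange = solve-∀ ℚ-ring
    -- Numerators and denominators are paired with an offset of one: the numerator with index i + 1
    -- goes with the denominator with index i and forms a factor of `η̄`. What remains is the first
    -- numerator p (1 + 2 x) over the last denominator p (2 + 2 x), that is `t x`.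
    upper : Π< (suc m) (λ i → f (m ℕ.+ i)) ≡ η̄ (1 ℕ.+ 2 ℕ.* x) * t x
    upper = begin
      Π< (suc m) (λ i → f (m ℕ.+ i))
        ≡⟨ Π-cong (suc m) {λ i → f (m ℕ.+ i)} {λ i → a i * b i} (λ i _ → cong₂ (λ u v → ℕ→ℚ u * invℕ v) (odd p m p≡1+2m x i) (cong suc (odd p m p≡1+2m x i))) ⟩
      Π< (suc m) (λ i → a i * b i)
        ≡⟨ Π-* (suc m) a b ⟩
      (a 0 * Π< m (λ i → a (suc i))) * Π< (suc m) b
        ≡⟨ cong₂ (λ u v → (a 0 * u) * v) (Π-cong m {λ i → a (suc i)} λ i _ → cong ℕ→ℚ (next y i)) (Π-last m b) ⟩
      (a 0 * Π< m (λ i → ℕ→ℚ (2 ℕ.+ (y ℕ.+ 2 ℕ.* i)))) * (Π< m b * b m)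
        ≡⟨ rearrange (a 0) (Π< m (λ i → ℕ→ℚ (2 ℕ.+ (y ℕ.+ 2 ℕ.* i)))) (Π< m b) (b m) ⟩
      (Π< m (λ i → ℕ→ℚ (2 ℕ.+ (y ℕ.+ 2 ℕ.* i))) * Π< m b) * (a 0 * b m)
        ≡⟨ cong₂ _*_ (sym (Π-* m (λ i → ℕ→ℚ (2 ℕ.+ (y ℕ.+ 2 ℕ.* i))) b))
             (cong₂ (λ u v → ℕ→ℚ u * invℕ v) (ℕ.+-identityʳ y) (top p m p≡1+2m x)) ⟩
      η̄ (1 ℕ.+ 2 ℕ.* x) * frac y (p ℕ.* (2 ℕ.+ 2 ℕ.* x))
        ≡⟨ cong (η̄ (1 ℕ.+ 2 ℕ.* x) *_) (frac-scale p (1 ℕ.+ 2 ℕ.* x) (2 ℕ.+ 2 ℕ.* x)) ⟩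
      η̄ (1 ℕ.+ 2 ℕ.* x) * t x ∎

  α[px+b] : ∀ x b → α (p ℕ.* x ℕ.+ b) ≡ α (p ℕ.* x) * τ b x
  α[px+b] x b = begin
    α (p ℕ.* x ℕ.+ b)               ≡⟨ α≡Π (p ℕ.* x ℕ.+ b) ⟩
    Π< (p ℕ.* x ℕ.+ b) t            ≡⟨ Π-split (p ℕ.* x) b t ⟩
    Π< (p ℕ.* x) t * τ b x          ≡⟨ cong (_* τ b x) (α≡Π (p ℕ.* x)) ⟨
    α (p ℕ.* x) * τ b x             ∎
    where open ≡-Reasoning

  α[px] : ∀ x → α (p ℕ.* x) ≡ c x * α x
  α[px] zero    = cong α (ℕ.*-zeroʳ p)
  α[px] (suc x) = begin
    α (p ℕ.* suc x)                 ≡⟨ cong α (trans (ℕ.*-suc p x) (ℕ.+-comm p (p ℕ.* x))) ⟩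
    α (p ℕ.* x ℕ.+ p)               ≡⟨ α[px+b] x p ⟩
    α (p ℕ.* x) * τ p x             ≡⟨ cong₂ _*_ (α[px] x) (τ-p x) ⟩
    c x * α x * (κ x * t x)         ≡⟨ lemma (c x) (α x) (κ x) (t x) ⟩
    c x * κ x * (α x * t x)         ≡⟨ cong₂ _*_ (c-suc x) (α-suc x) ⟨
    c (suc x) * α (suc x)           ∎
    where
    open ≡-Reasoning
    lemma : ∀ a b c d → a * b * (c * d) ≡ a * c * (b * d)
    lemma = solve-∀ ℚ-ring

  -- Moving the window by one place trades `u s` for `u (N + s)`, which is congruent to it; the unit
  -- `u s` can be cancelled.
  Π-shift : ∀ {k} N u → (∀ i → Unit (u i)) → (∀ i → u (N ℕ.+ i) ≈ u i [ k ]) →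
            ∀ s → Π< N (λ i → u (i ℕ.+ s)) ≈ Π< N u [ k ]
  Π-shift {k} N u units periodic zero    = ≈-reflexive (Π-cong N λ i _ → cong u (ℕ.+-identityʳ i))
  Π-shift {k} N u units periodic (suc s) = ≈-trans (≈-cancel (units s) rotate) (Π-shift N u units periodic s)
    where
    P : ℕ → ℚ
    P s = Π< N (λ i → u (i ℕ.+ s))
    rotate-≡ : u s * P (suc s) ≡ P s * u (N ℕ.+ s)
    rotate-≡ = trans (cong (u s *_) (Π-cong N λ i _ → cong u (ℕ.+-suc i s))) (Π-last N (λ i → u (i ℕ.+ s)))
    rotate : u s * P (suc s) ≈ u s * P s [ k ]
    rotate = ≈-trans (≈-reflexive rotate-≡)
      (≈-trans (≈-*ˡ (integral-Π N λ i _ → integral (units (i ℕ.+ s))) (periodic s)) (≈-reflexive (*-comm (P s) (u s))))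

  p^-odd : ∀ k → ∃[ M ] p ℕ.^ k ≡ suc (M ℕ.+ M)
  p^-odd zero    = 0 , refl
  p^-odd (suc k) =
    let M , eq = p^-odd k
    in M ℕ.+ m ℕ.+ 2 ℕ.* m ℕ.* M , trans (cong₂ ℕ._*_ p≡1+2m eq) (lemma m M)
    where
    lemma : ∀ m M → suc (m ℕ.+ m) ℕ.* suc (M ℕ.+ M) ≡ suc ((M ℕ.+ m ℕ.+ 2 ℕ.* m ℕ.* M) ℕ.+ (M ℕ.+ m ℕ.+ 2 ℕ.* m ℕ.* M))
    lemma = ℕSolver.solve-∀

  -- As p ^ k is odd and η has period p ^ k modulo p ^ (k + 1), translation by
  -- p ^ k exchanges the even and the odd arguments.
  η-even≈η-odd : ∀ k x → Π< (p ℕ.^ k) (λ i → η (2 ℕ.* (x ℕ.+ i))) ≈ Π< (p ℕ.^ k) (λ i → η (1 ℕ.+ 2 ℕ.* (x ℕ.+ i))) [ suc k ]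
  η-even≈η-odd k x = ≈-trans (≈-sym (Π-shift N u (λ i → η-unit (2 ℕ.* (x ℕ.+ i))) periodic (suc M)))
    (≈-Π N (λ i _ → integral (η-unit (2 ℕ.* (x ℕ.+ (i ℕ.+ suc M))))) (λ i _ → integral (η-unit (1 ℕ.+ 2 ℕ.* (x ℕ.+ i)))) swap)
    where
    N = p ℕ.^ k
    M = proj₁ (p^-odd k)
    N≡ : N ≡ suc (M ℕ.+ M)
    N≡ = proj₂ (p^-odd k)
    u : ℕ → ℚ
    u i = η (2 ℕ.* (x ℕ.+ i))
    two-periods : ∀ N x i → 2 ℕ.* (x ℕ.+ i) ℕ.+ N ℕ.+ N ≡ 2 ℕ.* (x ℕ.+ (N ℕ.+ i))
    two-periods = ℕSolver.solve-∀
    periodic : ∀ i → u (N ℕ.+ i) ≈ u i [ suc k ]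
    periodic i = subst (λ y → η y ≈ u i [ suc k ]) (two-periods N x i)
      (≈-trans (η-lipschitz k (2 ℕ.* (x ℕ.+ i) ℕ.+ N)) (η-lipschitz k (2 ℕ.* (x ℕ.+ i))))
    -- The shift `suc M` is half of p ^ k + 1: doubled, it turns an even argument into the following
    -- odd one plus p ^ k.
    even : ∀ M x i → 1 ℕ.+ 2 ℕ.* (x ℕ.+ i) ℕ.+ suc (M ℕ.+ M) ≡ 2 ℕ.* (x ℕ.+ (i ℕ.+ suc M))
    even = ℕSolver.solve-∀
    swap : ∀ i → i ℕ.< N → u (i ℕ.+ suc M) ≈ η (1 ℕ.+ 2 ℕ.* (x ℕ.+ i)) [ suc k ]
    swap i _ = subst (λ y → η y ≈ η (1 ℕ.+ 2 ℕ.* (x ℕ.+ i)) [ suc k ])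
      (trans (cong (1 ℕ.+ 2 ℕ.* (x ℕ.+ i) ℕ.+_) N≡) (even M x i)) (η-lipschitz k (1 ℕ.+ 2 ℕ.* (x ℕ.+ i)))

  -- The quotient of the two sides is the product of `κ` over a window of length p ^ k, where the
  -- values of `η` at even arguments cancel against those at odd arguments.
  c-lipschitz : ∀ k x → c (x ℕ.+ p ℕ.^ k) ≈ c x [ suc k ]
  c-lipschitz k x = ≈-trans (≈-reflexive (Π-split x N κ))
    (≈-trans (≈-*ˡ (integral (c-unit x)) window) (≈-reflexive (*-identityʳ (c x))))
    where
    N = p ℕ.^ k
    evens odds odds̄ : ℕ → ℚ
    evens i = η (2 ℕ.* (x ℕ.+ i))
    odds  i = η (1 ℕ.+ 2 ℕ.* (x ℕ.+ i))
    odds̄ i  = η̄ (1 ℕ.+ 2 ℕ.* (x ℕ.+ i))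
    window : Π< N (λ i → κ (x ℕ.+ i)) ≈ 1ℚ [ suc k ]
    window = ≈-trans (≈-reflexive (Π-* N evens odds̄))
      (≈-trans (≈-*ʳ (integral-Π N λ i _ → integral (η̄-unit (1 ℕ.+ 2 ℕ.* (x ℕ.+ i)))) (η-even≈η-odd k x))
        (≈-reflexive (trans (sym (Π-* N odds odds̄)) (Π-1 N λ i → η*η̄ (1 ℕ.+ 2 ℕ.* (x ℕ.+ i))))))

  -- Numerators and denominators at y, 1 + y, 2 + y are in arithmetic progression with difference p,
  -- and (N - p) (N + p) ≡ N² modulo p².
  e-geometric : ∀ y j → j ℕ.< m → e (p ℕ.* y ℕ.+ 2 ℕ.* j) * e (p ℕ.* (2 ℕ.+ y) ℕ.+ 2 ℕ.* j)
                ≈ e (p ℕ.* (1 ℕ.+ y) ℕ.+ 2 ℕ.* j) * e (p ℕ.* (1 ℕ.+ y) ℕ.+ 2 ℕ.* j) [ 2 ]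
  e-geometric y j j<m = ≈-trans (≈-reflexive (frac-* (1 ℕ.+ n₀) (2 ℕ.+ n₀) (1 ℕ.+ n₂) (2 ℕ.+ n₂)))
    (≈-trans (≈-frac {2} {(1 ℕ.+ n₀) ℕ.* (1 ℕ.+ n₂)} {(1 ℕ.+ n₁) ℕ.* (1 ℕ.+ n₁)}
        (p∤* (p∤2+py+2j y j<m) (p∤2+py+2j (2 ℕ.+ y) j<m)) (p∤* (p∤2+py+2j (1 ℕ.+ y) j<m) (p∤2+py+2j (1 ℕ.+ y) j<m))
        (≈-ι 2 1 0 (square 1 p y (2 ℕ.* j))) (≈-ι 2 1 0 (square 2 p y (2 ℕ.* j))))
      (≈-reflexive (sym (frac-* (1 ℕ.+ n₁) (2 ℕ.+ n₁) (1 ℕ.+ n₁) (2 ℕ.+ n₁)))))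
    where
    n₀ = p ℕ.* y ℕ.+ 2 ℕ.* j
    n₁ = p ℕ.* (1 ℕ.+ y) ℕ.+ 2 ℕ.* j
    n₂ = p ℕ.* (2 ℕ.+ y) ℕ.+ 2 ℕ.* j
    square : ∀ i p y j → (i ℕ.+ (p ℕ.* y ℕ.+ j)) ℕ.* (i ℕ.+ (p ℕ.* (2 ℕ.+ y) ℕ.+ j)) ℕ.+ p ℕ.* (p ℕ.* 1) ℕ.* 1
             ≡ (i ℕ.+ (p ℕ.* (1 ℕ.+ y) ℕ.+ j)) ℕ.* (i ℕ.+ (p ℕ.* (1 ℕ.+ y) ℕ.+ j)) ℕ.+ p ℕ.* (p ℕ.* 1) ℕ.* 0
    square = ℕSolver.solve-∀

  η-geometric : ∀ y → η y * η (2 ℕ.+ y) ≈ η (1 ℕ.+ y) * η (1 ℕ.+ y) [ 2 ]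
  η-geometric y = ≈-trans (≈-reflexive (sym (Π-* m (f y) (f (2 ℕ.+ y)))))
    (≈-trans (≈-Π m (λ j j<m → integral (unit-* (e-unit y j j<m) (e-unit (2 ℕ.+ y) j j<m)))
                    (λ j j<m → integral (unit-* (e-unit (1 ℕ.+ y) j j<m) (e-unit (1 ℕ.+ y) j j<m))) (e-geometric y))
      (≈-reflexive (Π-* m (f (1 ℕ.+ y)) (f (1 ℕ.+ y)))))
    where
    f : ℕ → ℕ → ℚ
    f y j = e (p ℕ.* y ℕ.+ 2 ℕ.* j)

  -- Passing from x to x + 1 multiplies the left side by η y · η (y + 2) / η (y + 1)² with y = 2 x,
  -- which is 1 modulo p² by `η-geometric`.
  c²η≈η0 : ∀ x → c x * c x * η (2 ℕ.* x) ≈ η 0 [ 2 ]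
  c²η≈η0 zero    = ≈-reflexive (trans (cong (_* η 0) (*-identityˡ 1ℚ)) (*-identityˡ (η 0)))
  c²η≈η0 (suc x) = ≈-trans (≈-reflexive regroup) (≈-trans (≈-*ˡ (integral-* (integral (unit-* (c-unit x) (c-unit x))) (integral (η-unit y))) ratio)
    (≈-trans (≈-reflexive (*-identityʳ _)) (c²η≈η0 x)))
    where
    y = 2 ℕ.* x
    lemma : ∀ c a b d → c * (a * b) * (c * (a * b)) * d ≡ c * c * a * (a * d * (b * b))
    lemma = solve-∀ ℚ-ring
    next : ∀ x → 2 ℕ.* suc x ≡ 2 ℕ.+ 2 ℕ.* x
    next = ℕSolver.solve-∀
    regroup : c (suc x) * c (suc x) * η (2 ℕ.* suc x) ≡ c x * c x * η y * (η y * η (2 ℕ.+ y) * (η̄ (1 ℕ.+ y) * η̄ (1 ℕ.+ y)))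
    regroup = trans (cong₂ (λ u v → u * u * η v) (c-suc x) (next x)) (lemma (c x) (η y) (η̄ (1 ℕ.+ y)) (η (2 ℕ.+ y)))
    collect : ∀ a b → a * a * (b * b) ≡ a * b * (a * b)
    collect = solve-∀ ℚ-ring
    ratio : η y * η (2 ℕ.+ y) * (η̄ (1 ℕ.+ y) * η̄ (1 ℕ.+ y)) ≈ 1ℚ [ 2 ]
    ratio = ≈-trans (≈-*ʳ (integral (unit-* (η̄-unit (1 ℕ.+ y)) (η̄-unit (1 ℕ.+ y)))) (η-geometric y))
      (≈-reflexive (trans (collect (η (1 ℕ.+ y)) (η̄ (1 ℕ.+ y))) (cong₂ _*_ (η*η̄ (1 ℕ.+ y)) (η*η̄ (1 ℕ.+ y)))))

  -- Behaviour of the ratios under the reflection of b to m - b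

  r : ℕ → ℕ → ℚ
  r b x = c x * τ b x

  α-ratio : ∀ b x → α (b ℕ.+ p ℕ.* x) ≡ r b x * α x
  α-ratio b x = trans (cong α (ℕ.+-comm b (p ℕ.* x))) (trans (α[px+b] x b)
    (trans (cong (_* τ b x) (α[px] x)) (lemma (c x) (α x) (τ b x))))
    where
    lemma : ∀ c a t → c * a * t ≡ c * t * a
    lemma = solve-∀ ℚ-ring

  r-integral : ∀ b x → b ℕ.< p → Integral (r b x)
  r-integral b x b<p = integral-* (integral (c-unit x)) (τ-integral b x b<p)

  r-unit : ∀ b x → b ℕ.≤ m → Unit (r b x)
  r-unit b x b≤m = unit-* (c-unit x) (unit-Π b λ j j<b → t-unit x (ℕ.<-≤-trans j<b b≤m))

  r-lipschitz : ∀ b → b ℕ.< p → ∀ k x → r b (x ℕ.+ p ℕ.^ k) ≈ r b x [ suc k ]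
  r-lipschitz b b<p k x = ≈-* (integral (c-unit (x ℕ.+ p ℕ.^ k))) (τ-integral b x b<p) (c-lipschitz k x) (τ-lipschitz b b<p k x)

  r-suc : ∀ b x → r (suc b) x ≡ r b x * t (p ℕ.* x ℕ.+ b)
  r-suc b x = trans (cong (c x *_) (τ-suc b x)) (sym (*-assoc (c x) (τ b x) _))

  r0 : ∀ x → r 0 x ≡ c x
  r0 x = *-identityʳ (c x)

  p≡3+2b+2b′ : ∀ b b′ → suc b ℕ.+ b′ ≡ m → p ≡ 3 ℕ.+ 2 ℕ.* (b ℕ.+ b′)
  p≡3+2b+2b′ b b′ refl = trans p≡1+2m (lemma b b′)
    where
    lemma : ∀ b b′ → suc ((suc b ℕ.+ b′) ℕ.+ (suc b ℕ.+ b′)) ≡ 3 ℕ.+ 2 ℕ.* (b ℕ.+ b′)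
    lemma = ℕSolver.solve-∀

  -- A division-free form of: t (p a + b) / t (p a + b′) does not depend on a modulo p².
  -- Cross-multiplication pairs each numerator with the denominator of the reflected ratio, and
  -- their constant terms 1 + 2 b and 2 + 2 b′ add up to p.
  t-swap : ∀ {b b′} → suc b ℕ.+ b′ ≡ m → ∀ a →
           t (p ℕ.* a ℕ.+ b) * t (p ℕ.* 0 ℕ.+ b′) ≈ t (p ℕ.* a ℕ.+ b′) * t (p ℕ.* 0 ℕ.+ b) [ 2 ]
  t-swap {b} {b′} b+b′ a = ≈-trans (≈-reflexive (frac-* (1 ℕ.+ n) (2 ℕ.+ n) (1 ℕ.+ n₀′) (2 ℕ.+ n₀′)))
    (≈-trans (≈-frac-cross {2} {(1 ℕ.+ n) ℕ.* (1 ℕ.+ n₀′)} {(1 ℕ.+ n′) ℕ.* (1 ℕ.+ n₀)}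
        (p∤* (p∤2+2[px+j] a b<) (p∤2+2[px+j] 0 b′<)) (p∤* (p∤2+2[px+j] a b′<) (p∤2+2[px+j] 0 b<)) cross)
      (≈-reflexive (sym (frac-* (1 ℕ.+ n′) (2 ℕ.+ n′) (1 ℕ.+ n₀) (2 ℕ.+ n₀)))))
    where
    n n′ n₀ n₀′ : ℕ
    n   = 2 ℕ.* (p ℕ.* a ℕ.+ b)
    n′  = 2 ℕ.* (p ℕ.* a ℕ.+ b′)
    n₀  = 2 ℕ.* (p ℕ.* 0 ℕ.+ b)
    n₀′ = 2 ℕ.* (p ℕ.* 0 ℕ.+ b′)
    b< : suc b ℕ.< p
    b< = ℕ.≤-<-trans (subst (suc b ℕ.≤_) b+b′ (ℕ.m≤m+n (suc b) b′)) m<p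
    b′< : suc b′ ℕ.< p
    b′< = ℕ.≤-<-trans (subst (suc b′ ℕ.≤_) b+b′ (s≤s (ℕ.m≤n+m b′ b))) m<p
    -- For s = 1 + 2b and X = 2pa this is (X + s) (X + p - s) = s (p - s) + X (X + p).
    product≈ : ∀ p a b b′ → p ≡ 3 ℕ.+ 2 ℕ.* (b ℕ.+ b′) →
      (1 ℕ.+ 2 ℕ.* (p ℕ.* a ℕ.+ b)) ℕ.* (2 ℕ.+ 2 ℕ.* (p ℕ.* a ℕ.+ b′)) ℕ.+ p ℕ.* (p ℕ.* 1) ℕ.* 0 ≡
      (1 ℕ.+ 2 ℕ.* (p ℕ.* 0 ℕ.+ b)) ℕ.* (2 ℕ.+ 2 ℕ.* (p ℕ.* 0 ℕ.+ b′)) ℕ.+ p ℕ.* (p ℕ.* 1) ℕ.* (4 ℕ.* a ℕ.* a ℕ.+ 2 ℕ.* a)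
    product≈ _ a b b′ refl = lemma a b b′
      where
      lemma : ∀ a b b′ → let p = 3 ℕ.+ 2 ℕ.* (b ℕ.+ b′) in
        (1 ℕ.+ 2 ℕ.* (p ℕ.* a ℕ.+ b)) ℕ.* (2 ℕ.+ 2 ℕ.* (p ℕ.* a ℕ.+ b′)) ℕ.+ p ℕ.* (p ℕ.* 1) ℕ.* 0 ≡
        (1 ℕ.+ 2 ℕ.* (p ℕ.* 0 ℕ.+ b)) ℕ.* (2 ℕ.+ 2 ℕ.* (p ℕ.* 0 ℕ.+ b′)) ℕ.+ p ℕ.* (p ℕ.* 1) ℕ.* (4 ℕ.* a ℕ.* a ℕ.+ 2 ℕ.* a)
      lemma = ℕSolver.solve-∀
    p≡ : p ≡ 3 ℕ.+ 2 ℕ.* (b ℕ.+ b′)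
    p≡ = p≡3+2b+2b′ b b′ b+b′
    first : ℕ→ℚ ((1 ℕ.+ n) ℕ.* (2 ℕ.+ n′)) ≈ ℕ→ℚ ((1 ℕ.+ n₀) ℕ.* (2 ℕ.+ n₀′)) [ 2 ]
    first = ≈-ι 2 0 (4 ℕ.* a ℕ.* a ℕ.+ 2 ℕ.* a) (product≈ p a b b′ p≡)
    second : ℕ→ℚ ((1 ℕ.+ n′) ℕ.* (2 ℕ.+ n)) ≈ ℕ→ℚ ((1 ℕ.+ n₀′) ℕ.* (2 ℕ.+ n₀)) [ 2 ]
    second = ≈-ι 2 0 (4 ℕ.* a ℕ.* a ℕ.+ 2 ℕ.* a) (product≈ p a b′ b (trans p≡ (cong (λ s → 3 ℕ.+ 2 ℕ.* s) (ℕ.+-comm b b′))))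
    regroup : ∀ i j k l → i ℕ.* j ℕ.* (k ℕ.* l) ≡ i ℕ.* k ℕ.* (j ℕ.* l)
    regroup = ℕSolver.solve-∀
    regroup′ : ∀ i j k l → i ℕ.* j ℕ.* (k ℕ.* l) ≡ k ℕ.* i ℕ.* (l ℕ.* j)
    regroup′ = ℕSolver.solve-∀
    ι-regroup : ∀ u v u′ v′ → u ℕ.* v ≡ u′ ℕ.* v′ → ℕ→ℚ u * ℕ→ℚ v ≡ ℕ→ℚ u′ * ℕ→ℚ v′
    ι-regroup u v u′ v′ eq = trans (sym (ι-* u v)) (trans (cong ℕ→ℚ eq) (ι-* u′ v′))
    cross : ℕ→ℚ ((1 ℕ.+ n) ℕ.* (1 ℕ.+ n₀′)) * ℕ→ℚ ((2 ℕ.+ n′) ℕ.* (2 ℕ.+ n₀))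
            ≈ ℕ→ℚ ((1 ℕ.+ n′) ℕ.* (1 ℕ.+ n₀)) * ℕ→ℚ ((2 ℕ.+ n) ℕ.* (2 ℕ.+ n₀′)) [ 2 ]
    cross = ≈-trans
      (≈-reflexive (ι-regroup ((1 ℕ.+ n) ℕ.* (1 ℕ.+ n₀′)) ((2 ℕ.+ n′) ℕ.* (2 ℕ.+ n₀)) ((1 ℕ.+ n) ℕ.* (2 ℕ.+ n′)) ((1 ℕ.+ n₀′) ℕ.* (2 ℕ.+ n₀))
        (regroup (1 ℕ.+ n) (1 ℕ.+ n₀′) (2 ℕ.+ n′) (2 ℕ.+ n₀))))
      (≈-trans (≈-* (integral-ι ((1 ℕ.+ n) ℕ.* (2 ℕ.+ n′))) (integral-ι ((1 ℕ.+ n′) ℕ.* (2 ℕ.+ n))) first (≈-sym second))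
        (≈-reflexive (ι-regroup ((1 ℕ.+ n₀) ℕ.* (2 ℕ.+ n₀′)) ((1 ℕ.+ n′) ℕ.* (2 ℕ.+ n)) ((1 ℕ.+ n′) ℕ.* (1 ℕ.+ n₀)) ((2 ℕ.+ n) ℕ.* (2 ℕ.+ n₀′))
          (regroup′ (1 ℕ.+ n₀) (2 ℕ.+ n₀′) (1 ℕ.+ n′) (2 ℕ.+ n)))))

  -- Raising b by one and lowering b′ by one multiplies the product by t (p a + b) / t (p a + b′),
  -- whose dependence on a is removed by `t-swap`. For b = 0 the product is c a · c a · η (2 a).
  r-product : ∀ b b′ → b ℕ.+ b′ ≡ m → ∀ a → r b a * r b′ a ≈ r b 0 * r b′ 0 [ 2 ]
  r-product zero    b′ refl a = ≈-trans (≈-reflexive left) (≈-trans (c²η≈η0 a) (≈-reflexive right))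
    where
    lemma : ∀ c t → c * (c * t) ≡ c * c * t
    lemma = solve-∀ ℚ-ring
    left : r 0 a * r m a ≡ c a * c a * η (2 ℕ.* a)
    left = trans (cong₂ (λ u v → u * (c a * v)) (r0 a) (τ-m a)) (lemma (c a) (η (2 ℕ.* a)))
    right : η 0 ≡ r 0 0 * r m 0
    right = sym (trans (*-identityˡ (r m 0)) (trans (*-identityˡ (τ m 0)) (τ-m 0)))
  r-product (suc b) b′ b+b′ a = ≈-cancel (unit-* (t-unit a b′<m) (t-unit 0 b′<m))
    (≈-trans (≈-reflexive left)
      (≈-trans (≈-* (integral-* (r-integral b a b<p) (r-integral (suc b′) a 1+b′<p))
                    (integral-* (t-integral a 1+b′<p) (t-integral 0 1+b<p))
                    (r-product b (suc b′) (trans (ℕ.+-suc b b′) b+b′) a) (t-swap b+b′ a))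
        (≈-reflexive right)))
    where
    b′<m : b′ ℕ.< m
    b′<m = subst (b′ ℕ.<_) b+b′ (s≤s (ℕ.m≤n+m b′ b))
    1+b≤m : suc b ℕ.≤ m
    1+b≤m = subst (suc b ℕ.≤_) b+b′ (ℕ.m≤m+n (suc b) b′)
    1+b<p : suc b ℕ.< p
    1+b<p = ℕ.≤-<-trans 1+b≤m m<p
    b<p : b ℕ.< p
    b<p = ℕ.<-trans (ℕ.n<1+n b) 1+b<p
    1+b′<p : suc b′ ℕ.< p
    1+b′<p = ℕ.≤-<-trans b′<m m<p
    lemma₁ : ∀ r r′ tb tb′ t₀ → (tb′ * t₀) * (r * tb * r′) ≡ (r * (r′ * tb′)) * (tb * t₀)
    lemma₁ = solve-∀ ℚ-ring
    lemma₂ : ∀ r r′ tb tb′ t₀ → (r * (r′ * t₀)) * (tb′ * tb) ≡ (tb′ * t₀) * (r * tb * r′)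
    lemma₂ = solve-∀ ℚ-ring
    left : t (p ℕ.* a ℕ.+ b′) * t (p ℕ.* 0 ℕ.+ b′) * (r (suc b) a * r b′ a)
         ≡ (r b a * r (suc b′) a) * (t (p ℕ.* a ℕ.+ b) * t (p ℕ.* 0 ℕ.+ b′))
    left = trans (cong (λ u → t (p ℕ.* a ℕ.+ b′) * t (p ℕ.* 0 ℕ.+ b′) * (u * r b′ a)) (r-suc b a))
      (trans (lemma₁ (r b a) (r b′ a) (t (p ℕ.* a ℕ.+ b)) (t (p ℕ.* a ℕ.+ b′)) (t (p ℕ.* 0 ℕ.+ b′)))
        (cong (λ u → (r b a * u) * (t (p ℕ.* a ℕ.+ b) * t (p ℕ.* 0 ℕ.+ b′))) (sym (r-suc b′ a))))
    right : (r b 0 * r (suc b′) 0) * (t (p ℕ.* a ℕ.+ b′) * t (p ℕ.* 0 ℕ.+ b))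
          ≡ t (p ℕ.* a ℕ.+ b′) * t (p ℕ.* 0 ℕ.+ b′) * (r (suc b) 0 * r b′ 0)
    right = trans (cong (λ u → (r b 0 * u) * (t (p ℕ.* a ℕ.+ b′) * t (p ℕ.* 0 ℕ.+ b))) (r-suc b′ 0))
      (trans (lemma₂ (r b 0) (r b′ 0) (t (p ℕ.* 0 ℕ.+ b)) (t (p ℕ.* a ℕ.+ b′)) (t (p ℕ.* 0 ℕ.+ b′)))
        (cong (λ u → t (p ℕ.* a ℕ.+ b′) * t (p ℕ.* 0 ℕ.+ b′) * (u * r b′ 0)) (sym (r-suc b 0))))

  -- For b > m the product τ b x contains the ratio with numerator p (2 x + 1).
  r-divisible : ∀ i x → suc m ℕ.+ i ℕ.< p → Divisible 1 (r (suc m ℕ.+ i) x)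
  r-divisible zero x 1+m<p = subst (Divisible 1) (sym (r-suc-at x)) (div-*ˡ (r-integral m x m<p) t-divisible)
    where
    r-suc-at : ∀ x → r (suc m ℕ.+ 0) x ≡ r m x * t (p ℕ.* x ℕ.+ m)
    r-suc-at x = trans (cong (λ n → r n x) (ℕ.+-identityʳ (suc m))) (r-suc m x)
    num : ∀ p m → p ≡ suc (m ℕ.+ m) → ∀ x → 1 ℕ.+ 2 ℕ.* (p ℕ.* x ℕ.+ m) ≡ p ℕ.* 1 ℕ.* (1 ℕ.+ 2 ℕ.* x)
    num _ m refl x = lemma m x
      where
      lemma : ∀ m x → 1 ℕ.+ 2 ℕ.* (suc (m ℕ.+ m) ℕ.* x ℕ.+ m) ≡ suc (m ℕ.+ m) ℕ.* 1 ℕ.* (1 ℕ.+ 2 ℕ.* x)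
      lemma = ℕSolver.solve-∀
    den : ℕ
    den = 2 ℕ.+ 2 ℕ.* (p ℕ.* x ℕ.+ m)
    t-divisible : Divisible 1 (t (p ℕ.* x ℕ.+ m))
    t-divisible = mkDivisible (frac (1 ℕ.+ 2 ℕ.* x) den)
      (integral-frac (1 ℕ.+ 2 ℕ.* x) (p∤2+2[px+j] x (subst (ℕ._< p) (ℕ.+-identityʳ (suc m)) 1+m<p)))
      (trans (cong (_* invℕ den) (trans (cong ℕ→ℚ (num p m p≡1+2m x)) (ι-* (p ℕ.* 1) (1 ℕ.+ 2 ℕ.* x))))
        (*-assoc (ℕ→ℚ (p ℕ.* 1)) (ℕ→ℚ (1 ℕ.+ 2 ℕ.* x)) (invℕ den)))
  r-divisible (suc i) x b<p = subst (Divisible 1) (sym step)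
      (div-*ˡ (t-integral x 1+b<p) (r-divisible i x (ℕ.<-trans (ℕ.n<1+n _) 1+b<p)))
    where
    b : ℕ
    b = suc m ℕ.+ i
    1+b<p : suc b ℕ.< p
    1+b<p = subst (ℕ._< p) (ℕ.+-suc (suc m) i) b<p
    step : r (suc m ℕ.+ suc i) x ≡ t (p ℕ.* x ℕ.+ b) * r b x
    step = trans (cong (λ n → r n x) (ℕ.+-suc (suc m) i)) (trans (r-suc b x) (*-comm (r b x) (t (p ℕ.* x ℕ.+ b))))

  -- Each numerator plus the denominator of the other ratio is p, so modulo p they are opposite, and
  -- the two signs cancel.
  t-reflect : ∀ {b b′} → suc b ℕ.+ b′ ≡ m → t (p ℕ.* 0 ℕ.+ b′) * t (p ℕ.* 0 ℕ.+ b) ≈ 1ℚ [ 1 ]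
  t-reflect {b} {b′} b+b′ = ≈-trans (≈-reflexive (frac-* (1 ℕ.+ n₀′) (2 ℕ.+ n₀′) (1 ℕ.+ n₀) (2 ℕ.+ n₀)))
    (≈-trans (≈-frac {1} {(1 ℕ.+ n₀′) ℕ.* (1 ℕ.+ n₀)} {D} p∤D p∤D
        (≈-ι 1 1 0 (lemma₀ p b b′ (p≡3+2b+2b′ b b′ b+b′))) ≈-refl)
      (≈-reflexive (ι*invℕ D)))
    where
    n₀ n₀′ D : ℕ
    n₀  = 2 ℕ.* (p ℕ.* 0 ℕ.+ b)
    n₀′ = 2 ℕ.* (p ℕ.* 0 ℕ.+ b′)
    D = (2 ℕ.+ n₀′) ℕ.* (2 ℕ.+ n₀)
    p∤D : ¬ p ℕ.∣ D
    p∤D = p∤* (p∤2+2[px+j] 0 (ℕ.≤-<-trans (subst (b′ ℕ.<_) b+b′ (s≤s (ℕ.m≤n+m b′ b))) m<p))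
              (p∤2+2[px+j] 0 (ℕ.≤-<-trans (subst (suc b ℕ.≤_) b+b′ (ℕ.m≤m+n (suc b) b′)) m<p))
    lemma₀ : ∀ p b b′ → p ≡ 3 ℕ.+ 2 ℕ.* (b ℕ.+ b′) →
      (1 ℕ.+ 2 ℕ.* (p ℕ.* 0 ℕ.+ b′)) ℕ.* (1 ℕ.+ 2 ℕ.* (p ℕ.* 0 ℕ.+ b)) ℕ.+ p ℕ.* 1 ℕ.* 1
      ≡ (2 ℕ.+ 2 ℕ.* (p ℕ.* 0 ℕ.+ b′)) ℕ.* (2 ℕ.+ 2 ℕ.* (p ℕ.* 0 ℕ.+ b)) ℕ.+ p ℕ.* 1 ℕ.* 0
    lemma₀ _ b b′ refl = lemma b b′
      where
      lemma : ∀ b b′ → let p = 3 ℕ.+ 2 ℕ.* (b ℕ.+ b′) in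
        (1 ℕ.+ 2 ℕ.* (p ℕ.* 0 ℕ.+ b′)) ℕ.* (1 ℕ.+ 2 ℕ.* (p ℕ.* 0 ℕ.+ b)) ℕ.+ p ℕ.* 1 ℕ.* 1
        ≡ (2 ℕ.+ 2 ℕ.* (p ℕ.* 0 ℕ.+ b′)) ℕ.* (2 ℕ.+ 2 ℕ.* (p ℕ.* 0 ℕ.+ b)) ℕ.+ p ℕ.* 1 ℕ.* 0
      lemma = ℕSolver.solve-∀

  Π-reflect : ∀ {k} n {f g} → (∀ i → Integral (f i)) → (∀ i → Integral (g i)) →
              (∀ i j → suc i ℕ.+ j ≡ n → f i ≈ - g j [ k ]) → Π< n f ≈ (- 1ℚ) ^ n * Π< n g [ k ]
  Π-reflect zero            F G h = ≈-refl
  Π-reflect (suc n) {f} {g} F G h = ≈-trans (≈-reflexive (Π-reverse n f))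
    (≈-trans (≈-Π (suc n) (λ i _ → F (n ℕ.∸ i)) (λ i _ → integral-neg (G i))
        (λ { i (s≤s i≤n) → h (n ℕ.∸ i) i (cong suc (ℕ.m∸n+n≡m i≤n)) }))
      (≈-reflexive (Π-neg (suc n) g)))

  σ : ℚ
  σ = (- 1ℚ) ^ m

  σ*σ : σ * σ ≡ 1ℚ
  σ*σ = trans (sym (^-homo-* (- 1ℚ) m m)) (square≡1⇒^≡1 refl m)

  σ-integral : Integral σ
  σ-integral = integral-^ m (integral-neg integral-1)

  -- This is α m ≡ (-1) ^ m modulo p. Each odd numerator is p minus the even denominator in the
  -- mirrored position, and the m signs give `σ`.
  r-m-sign : r 0 0 ≈ σ * r m 0 [ 1 ]
  r-m-sign = ≈-sym (≈-trans (≈-reflexive left) (≈-trans (≈-*ˡ σ-integral (≈-*ʳ inv-product-integral num≈den)) (≈-reflexive right)))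
    where
    f g g⁻ : ℕ → ℚ
    f  i = ℕ→ℚ (1 ℕ.+ 2 ℕ.* (p ℕ.* 0 ℕ.+ i))
    g  i = ℕ→ℚ (2 ℕ.+ 2 ℕ.* (p ℕ.* 0 ℕ.+ i))
    g⁻ i = invℕ (2 ℕ.+ 2 ℕ.* (p ℕ.* 0 ℕ.+ i))
    inv-product-integral : Integral (Π< m g⁻)
    inv-product-integral = integral-Π m λ i i<m → integral (unit-invℕ (p∤2+2[px+j] 0 (ℕ.≤-<-trans i<m m<p)))
    left : σ * r m 0 ≡ σ * (Π< m f * Π< m g⁻)
    left = cong (σ *_) (trans (*-identityˡ (τ m 0)) (Π-* m f g⁻))
    sum≡p : ∀ p i j → p ≡ 3 ℕ.+ 2 ℕ.* (i ℕ.+ j) →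
      (1 ℕ.+ 2 ℕ.* (p ℕ.* 0 ℕ.+ i)) ℕ.+ (2 ℕ.+ 2 ℕ.* (p ℕ.* 0 ℕ.+ j)) ≡ p ℕ.* 1 ℕ.* 1
    sum≡p _ i j refl = lemma i j
      where
      lemma : ∀ i j → let p = 3 ℕ.+ 2 ℕ.* (i ℕ.+ j) in
        (1 ℕ.+ 2 ℕ.* (p ℕ.* 0 ℕ.+ i)) ℕ.+ (2 ℕ.+ 2 ℕ.* (p ℕ.* 0 ℕ.+ j)) ≡ p ℕ.* 1 ℕ.* 1
      lemma = ℕSolver.solve-∀
    lemma₁ : ∀ a b → a + b ≡ a - - b
    lemma₁ = solve-∀ ℚ-ring
    f≈-g : ∀ i j → suc i ℕ.+ j ≡ m → f i ≈ - g j [ 1 ]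
    f≈-g i j i+j = mk≈ (subst (Divisible 1) (lemma₁ (f i) (g j)) (mkDivisible 1ℚ integral-1
      (trans (sym (ι-+ (1 ℕ.+ 2 ℕ.* (p ℕ.* 0 ℕ.+ i)) (2 ℕ.+ 2 ℕ.* (p ℕ.* 0 ℕ.+ j))))
        (trans (cong ℕ→ℚ (sum≡p p i j (p≡3+2b+2b′ i j i+j))) (ι-* (p ℕ.* 1) 1)))))
    num≈den : Π< m f ≈ σ * Π< m g [ 1 ]
    num≈den = Π-reflect m {f} {g} (λ i → integral-ι (1 ℕ.+ 2 ℕ.* (p ℕ.* 0 ℕ.+ i))) (λ i → integral-ι (2 ℕ.+ 2 ℕ.* (p ℕ.* 0 ℕ.+ i))) f≈-g
    lemma₂ : ∀ s a b → s * (s * a * b) ≡ s * s * (a * b)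
    lemma₂ = solve-∀ ℚ-ring
    right : σ * (σ * Π< m g * Π< m g⁻) ≡ r 0 0
    right = trans (lemma₂ σ (Π< m g) (Π< m g⁻)) (trans (cong₂ _*_ σ*σ (sym (Π-* m g g⁻)))
      (trans (*-identityˡ _) (Π-1 m λ i → ι*invℕ (2 ℕ.+ 2 ℕ.* (p ℕ.* 0 ℕ.+ i)))))

  -- Symmetry of binomial coefficients in disguise: `r b 0` is α b, and since -1/2 ≡ m modulo p, it
  -- is congruent to (-1) ^ b times the binomial coefficient of m over b.
  r-reflect : ∀ b b′ → b ℕ.+ b′ ≡ m → r b 0 ≈ σ * r b′ 0 [ 1 ]
  r-reflect zero    b′ refl = r-m-sign
  r-reflect (suc b) b′ b+b′ = ≈-trans (≈-reflexive (r-suc b 0))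
    (≈-trans (≈-*ʳ (t-integral 0 1+b<p) (r-reflect b (suc b′) (trans (ℕ.+-suc b b′) b+b′)))
      (≈-trans (≈-reflexive regroup)
        (≈-trans (≈-*ˡ (integral-* σ-integral (r-integral b′ 0 b′<p)) (t-reflect b+b′)) (≈-reflexive (*-identityʳ _)))))
    where
    1+b<p : suc b ℕ.< p
    1+b<p = ℕ.≤-<-trans (subst (suc b ℕ.≤_) b+b′ (ℕ.m≤m+n (suc b) b′)) m<p
    b′<p : b′ ℕ.< p
    b′<p = ℕ.≤-<-trans (subst (b′ ℕ.≤_) b+b′ (ℕ.m≤n+m b′ (suc b))) m<p
    lemma : ∀ s r u v → s * (r * u) * v ≡ s * r * (u * v)
    lemma = solve-∀ ℚ-ring
    regroup : σ * r (suc b′) 0 * t (p ℕ.* 0 ℕ.+ b) ≡ σ * r b′ 0 * (t (p ℕ.* 0 ℕ.+ b′) * t (p ℕ.* 0 ℕ.+ b))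
    regroup = trans (cong (λ u → σ * u * t (p ℕ.* 0 ℕ.+ b)) (r-suc b′ 0)) (lemma σ (r b′ 0) (t (p ℕ.* 0 ℕ.+ b′)) (t (p ℕ.* 0 ℕ.+ b)))

-- The weights w b x and constancy of L 1 modulo p²

module Weights (d p m : ℕ) (2≤d : 2 ℕ.≤ d) (pr : Prime p) (p≢2 : p ≢ 2) (p≡1+2m : p ≡ suc (m ℕ.+ m)) where
  open Localization p pr
  open Coefficients p m pr p≢2 p≡1+2m

  z : ℚ
  z = ε d p

  z≡[-1]^dm : z ≡ (- 1ℚ) ^ (d ℕ.* m)
  z≡[-1]^dm = cong (λ n → (- 1ℚ) ^ (d ℕ.* n)) (begin
    (p ℕ.∸ 1) ℕ./ 2           ≡⟨ cong (λ n → (n ℕ.∸ 1) ℕ./ 2) p≡1+2m ⟩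
    (m ℕ.+ m) ℕ./ 2           ≡⟨ cong (ℕ._/ 2) (lemma m) ⟩
    m ℕ.* 2 ℕ./ 2             ≡⟨ ℕ.m*n/n≡m m 2 ⟩
    m                         ∎)
    where
    open ≡-Reasoning
    lemma : ∀ m → m ℕ.+ m ≡ m ℕ.* 2
    lemma = ℕSolver.solve-∀

  z≡σ^d : z ≡ σ ^ d
  z≡σ^d = trans z≡[-1]^dm (trans (cong ((- 1ℚ) ^_) (ℕ.*-comm d m)) (sym (^-assocʳ (- 1ℚ) m d)))

  z*z : z * z ≡ 1ℚ
  z*z = trans (cong₂ _*_ z≡[-1]^dm z≡[-1]^dm)
    (trans (sym (^-homo-* (- 1ℚ) (d ℕ.* m) (d ℕ.* m))) (square≡1⇒^≡1 refl (d ℕ.* m)))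

  -- Being fixed by the p-th power lets the same z reappear on the right of `A-ratio`, so a single
  -- operator `L` can be iterated.
  z^p : z ^ p ≡ z
  z^p = trans (cong (z ^_) p≡1+2m) (trans (cong (z *_) (square≡1⇒^≡1 z*z m)) (*-identityʳ z))

  -- The exponent contains m (m + 1), which is even. With z * z = 1 this matches the powers z ^ (b +
  -- 1) and z ^ (m - b) in `w-reflect`.
  z^[1+m] : z ^ suc m ≡ 1ℚ
  z^[1+m] = begin
    z ^ suc m                                 ≡⟨ cong (_^ suc m) z≡[-1]^dm ⟩
    ((- 1ℚ) ^ (d ℕ.* m)) ^ suc m              ≡⟨ ^-assocʳ (- 1ℚ) (d ℕ.* m) (suc m) ⟩
    (- 1ℚ) ^ (d ℕ.* m ℕ.* suc m)              ≡⟨ cong ((- 1ℚ) ^_) (lemma d m) ⟩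
    (- 1ℚ) ^ (m ℕ.* suc m ℕ.* d)              ≡⟨ ^-assocʳ (- 1ℚ) (m ℕ.* suc m) d ⟨
    ((- 1ℚ) ^ (m ℕ.* suc m)) ^ d              ≡⟨ cong (_^ d) ([-1]^n[1+n]≡1 m) ⟩
    1ℚ ^ d                                    ≡⟨ 1^n≡1 d ⟩
    1ℚ                                        ∎
    where
    open ≡-Reasoning
    lemma : ∀ d m → d ℕ.* m ℕ.* suc m ≡ m ℕ.* suc m ℕ.* d
    lemma = ℕSolver.solve-∀

  z-unit : Unit z
  z-unit = mkUnit z-integral z z-integral z*z
    where
    z-integral : Integral z
    z-integral = integral-^ (d ℕ.* ((p ℕ.∸ 1) ℕ./ 2)) (integral-neg integral-1)

  w : ℕ → ℕ → ℚ
  w b x = r b x ^ d * z ^ b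

  A : ℕ → ℚ
  A n = α n ^ d * z ^ n

  A-ratio : ∀ b x → A (b ℕ.+ p ℕ.* x) ≡ w b x * A x
  A-ratio b x = begin
    α (b ℕ.+ p ℕ.* x) ^ d * z ^ (b ℕ.+ p ℕ.* x)         ≡⟨ cong₂ _*_ (cong (_^ d) (α-ratio b x)) (^-homo-* z b (p ℕ.* x)) ⟩
    (r b x * α x) ^ d * (z ^ b * z ^ (p ℕ.* x))         ≡⟨ cong₂ (λ u v → u * (z ^ b * v)) (^-distrib-* (r b x) (α x) d) (sym (^-assocʳ z p x)) ⟩
    (r b x ^ d * α x ^ d) * (z ^ b * (z ^ p) ^ x)       ≡⟨ cong (λ u → (r b x ^ d * α x ^ d) * (z ^ b * u ^ x)) z^p ⟩
    (r b x ^ d * α x ^ d) * (z ^ b * z ^ x)             ≡⟨ lemma (r b x ^ d) (α x ^ d) (z ^ b) (z ^ x) ⟩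
    w b x * A x                                         ∎
    where
    open ≡-Reasoning
    lemma : ∀ a b c e → (a * b) * (c * e) ≡ (a * c) * (b * e)
    lemma = solve-∀ ℚ-ring

  open Transfer p pr w

  -- Stated at every x because the recursion evaluates `Φ s` at b + p x. At x = 0, where A 0 = 1, it
  -- becomes the truncated series.
  A*Φ : ∀ s x → A x * Φ s x ≡ Σ< (p ℕ.^ s) (λ n → A (n ℕ.+ p ℕ.^ s ℕ.* x))
  A*Φ zero    x = trans (*-identityʳ (A x)) (trans (cong A (sym (ℕ.*-identityˡ x))) (sym (+-identityʳ _)))
  A*Φ (suc s) x = begin
    A x * Σ< p (λ b → w b x * Φ s (b ℕ.+ p ℕ.* x))
      ≡⟨ *-Σ (A x) p (λ b → w b x * Φ s (b ℕ.+ p ℕ.* x)) ⟨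
    Σ< p (λ b → A x * (w b x * Φ s (b ℕ.+ p ℕ.* x)))
      ≡⟨ Σ-cong p (λ b _ → block b) ⟩
    Σ< p (λ b → Σ< N (λ n → A (n ℕ.+ N ℕ.* b ℕ.+ p ℕ.* N ℕ.* x)))
      ≡⟨ Σ-block p N (λ n → A (n ℕ.+ p ℕ.* N ℕ.* x)) ⟨
    Σ< (p ℕ.* N) (λ n → A (n ℕ.+ p ℕ.* N ℕ.* x)) ∎
    where
    open ≡-Reasoning
    N = p ℕ.^ s
    lemma : ∀ a w φ → a * (w * φ) ≡ (w * a) * φ
    lemma = solve-∀ ℚ-ring
    index : ∀ p N n b x → n ℕ.+ N ℕ.* (b ℕ.+ p ℕ.* x) ≡ n ℕ.+ N ℕ.* b ℕ.+ p ℕ.* N ℕ.* x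
    index = ℕSolver.solve-∀
    block : ∀ b → A x * (w b x * Φ s (b ℕ.+ p ℕ.* x)) ≡ Σ< N (λ n → A (n ℕ.+ N ℕ.* b ℕ.+ p ℕ.* N ℕ.* x))
    block b = begin
      A x * (w b x * Φ s (b ℕ.+ p ℕ.* x))                   ≡⟨ lemma (A x) (w b x) (Φ s (b ℕ.+ p ℕ.* x)) ⟩
      w b x * A x * Φ s (b ℕ.+ p ℕ.* x)                     ≡⟨ cong (_* Φ s (b ℕ.+ p ℕ.* x)) (A-ratio b x) ⟨
      A (b ℕ.+ p ℕ.* x) * Φ s (b ℕ.+ p ℕ.* x)               ≡⟨ A*Φ s (b ℕ.+ p ℕ.* x) ⟩
      Σ< N (λ n → A (n ℕ.+ N ℕ.* (b ℕ.+ p ℕ.* x)))          ≡⟨ Σ-cong N (λ n _ → cong A (index p N n b x)) ⟩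
      Σ< N (λ n → A (n ℕ.+ N ℕ.* b ℕ.+ p ℕ.* N ℕ.* x))      ∎

  T≡F : ∀ s → T s ≡ F d (p ℕ.^ s) z
  T≡F s = begin
    T s                                     ≡⟨ *-identityˡ (T s) ⟨
    1ℚ * T s                                ≡⟨ cong (_* T s) A0≡1 ⟨
    A 0 * T s                               ≡⟨ A*Φ s 0 ⟩
    Σ< N (λ n → A (n ℕ.+ N ℕ.* 0))          ≡⟨ Σ-cong N (λ n _ → cong A (trans (cong (n ℕ.+_) (ℕ.*-zeroʳ N)) (ℕ.+-identityʳ n))) ⟩
    Σ< N A                                  ≡⟨ sum≡Σ N A ⟨
    F d N z                                 ∎
    where
    open ≡-Reasoning
    N = p ℕ.^ s
    A0≡1 : A 0 ≡ 1ℚ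
    A0≡1 = trans (*-identityʳ _) (1^n≡1 d)

  w-integral : ∀ b x → b ℕ.< p → Integral (w b x)
  w-integral b x b<p = integral-* (integral-^ d (r-integral b x b<p)) (integral (unit-^ b z-unit))

  w-unit : ∀ b x → b ℕ.≤ m → Unit (w b x)
  w-unit b x b≤m = unit-* (unit-^ d (r-unit b x b≤m)) (unit-^ b z-unit)

  w-lipschitz : ∀ b → b ℕ.< p → Lipschitz 1 (w b)
  w-lipschitz b b<p k x = ≈-*ʳ (integral (unit-^ b z-unit))
    (≈-^ d (r-integral b (x ℕ.+ p ℕ.^ k) b<p) (r-integral b x b<p) (r-lipschitz b b<p k x))

  w-constant-mod-p : ∀ b → b ℕ.< p → ∀ x → w b x ≈ w b 0 [ 1 ]
  w-constant-mod-p b b<p = lipschitz⇒≈φ0 {1} {w b} (w-lipschitz b b<p)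

  w-product : ∀ b b′ → b ℕ.+ b′ ≡ m → ∀ a → w b a * w b′ a ≈ w b 0 * w b′ 0 [ 2 ]
  w-product b b′ b+b′ a = ≈-trans (≈-reflexive (regroup a))
    (≈-trans (≈-*ʳ (integral (unit-* (unit-^ b z-unit) (unit-^ b′ z-unit)))
        (≈-^ d (integral-* (r-integral b a b<p) (r-integral b′ a b′<p)) (integral-* (r-integral b 0 b<p) (r-integral b′ 0 b′<p))
          (r-product b b′ b+b′ a)))
      (≈-reflexive (sym (regroup 0))))
    where
    b<p : b ℕ.< p
    b<p = ℕ.≤-<-trans (subst (b ℕ.≤_) b+b′ (ℕ.m≤m+n b b′)) m<p
    b′<p : b′ ℕ.< p
    b′<p = ℕ.≤-<-trans (subst (b′ ℕ.≤_) b+b′ (ℕ.m≤n+m b′ b)) m<p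
    lemma : ∀ x y u v → (x * u) * (y * v) ≡ (x * y) * (u * v)
    lemma = solve-∀ ℚ-ring
    regroup : ∀ a → w b a * w b′ a ≡ (r b a * r b′ a) ^ d * (z ^ b * z ^ b′)
    regroup a = trans (lemma (r b a ^ d) (r b′ a ^ d) (z ^ b) (z ^ b′))
      (cong (_* (z ^ b * z ^ b′)) (sym (^-distrib-* (r b a) (r b′ a) d)))

  -- This is where the choice of the sign ε enters.
  w-reflect : ∀ b b′ → b ℕ.+ b′ ≡ m → w b 0 ≈ w b′ 0 [ 1 ]
  w-reflect b b′ b+b′ = ≈-trans
    (≈-*ʳ (integral (unit-^ b z-unit)) (≈-^ d (r-integral b 0 b<p) (integral-* σ-integral (r-integral b′ 0 b′<p)) (r-reflect b b′ b+b′)))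
    (≈-reflexive (begin
      (σ * r b′ 0) ^ d * z ^ b           ≡⟨ cong (_* z ^ b) (^-distrib-* σ (r b′ 0) d) ⟩
      σ ^ d * r b′ 0 ^ d * z ^ b         ≡⟨ cong (λ u → u * r b′ 0 ^ d * z ^ b) z≡σ^d ⟨
      z * r b′ 0 ^ d * z ^ b             ≡⟨ lemma₁ z (r b′ 0 ^ d) (z ^ b) ⟩
      r b′ 0 ^ d * z ^ suc b             ≡⟨ cong (r b′ 0 ^ d *_) z^[1+b]≡z^b′ ⟩
      w b′ 0                             ∎))
    where
    open ≡-Reasoning
    b<p : b ℕ.< p
    b<p = ℕ.≤-<-trans (subst (b ℕ.≤_) b+b′ (ℕ.m≤m+n b b′)) m<p
    b′<p : b′ ℕ.< p
    b′<p = ℕ.≤-<-trans (subst (b′ ℕ.≤_) b+b′ (ℕ.m≤n+m b′ b)) m<p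
    lemma₁ : ∀ z r y → z * r * y ≡ r * (z * y)
    lemma₁ = solve-∀ ℚ-ring
    z^[1+b]≡z^b′ : z ^ suc b ≡ z ^ b′
    z^[1+b]≡z^b′ = begin
      z ^ suc b                          ≡⟨ *-identityʳ _ ⟨
      z ^ suc b * 1ℚ                     ≡⟨ cong (z ^ suc b *_) (trans (sym (square≡1⇒^≡1 z*z b′)) (^-homo-* z b′ b′)) ⟩
      z ^ suc b * (z ^ b′ * z ^ b′)      ≡⟨ *-assoc (z ^ suc b) (z ^ b′) (z ^ b′) ⟨
      z ^ suc b * z ^ b′ * z ^ b′        ≡⟨ cong (_* z ^ b′) (^-homo-* z (suc b) b′) ⟨
      z ^ (suc b ℕ.+ b′) * z ^ b′        ≡⟨ cong (λ n → z ^ suc n * z ^ b′) b+b′ ⟩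
      z ^ suc m * z ^ b′                 ≡⟨ cong (_* z ^ b′) z^[1+m] ⟩
      1ℚ * z ^ b′                        ≡⟨ *-identityˡ _ ⟩
      z ^ b′                             ∎

  -- The factors `1ℚ` are the values of `Φ 0`, so that these are literally the differences of the
  -- terms of `Φ 1 x` and `Φ 1 0`.
  change : ℕ → ℕ → ℚ
  change x b = w b x * 1ℚ - w b 0 * 1ℚ

  -- With X ≈ X₀ ≈ Y₀ ≈ Y modulo p, the congruence X Y ≈ X₀ Y₀ modulo p² says
  -- X₀ ((X - X₀) + (Y - Y₀)) ≈ 0.
  change-pair : ∀ b b′ → b ℕ.+ b′ ≡ m → ∀ x → Divisible 2 (change x b + change x b′)
  change-pair b b′ b+b′ x = div-cancel (w-unit b 0 b≤m) (subst (Divisible 2) (lemma (w b x) (w b′ x) (w b 0) (w b′ 0))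
    (div-+ (difference (w-product b b′ b+b′ x))
      (div-+ (div-* (difference (w-constant-mod-p b b<p x)) (difference (w-reflect b b′ b+b′)))
        (div-neg (div-* (difference (w-constant-mod-p b b<p x)) (difference (w-constant-mod-p b′ b′<p x)))))))
    where
    b≤m : b ℕ.≤ m
    b≤m = subst (b ℕ.≤_) b+b′ (ℕ.m≤m+n b b′)
    b<p : b ℕ.< p
    b<p = ℕ.≤-<-trans b≤m m<p
    b′<p : b′ ℕ.< p
    b′<p = ℕ.≤-<-trans (subst (b′ ℕ.≤_) b+b′ (ℕ.m≤n+m b′ b)) m<p
    lemma : ∀ X Y X₀ Y₀ → (X * Y - X₀ * Y₀) + ((X - X₀) * (X₀ - Y₀) + (- ((X - X₀) * (Y - Y₀))))
          ≡ X₀ * ((X * 1ℚ - X₀ * 1ℚ) + (Y * 1ℚ - Y₀ * 1ℚ))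
    lemma = solve-∀ ℚ-ring

  -- Here d ≥ 2 enters: each factor `r b x` supplies one p, and its d-th power contains at least two
  -- of them.
  w-divisible : ∀ i x → suc m ℕ.+ i ℕ.< p → Divisible 2 (w (suc m ℕ.+ i) x)
  w-divisible i x b<p = subst (Divisible 2) (*-comm (z ^ b) (r b x ^ d))
    (div-*ˡ (integral (unit-^ b z-unit)) (subst (λ n → Divisible 2 (r b x ^ n)) (ℕ.m+[n∸m]≡n 2≤d)
      (subst (Divisible 2) (lemma (r b x) (r b x ^ (d ℕ.∸ 2)))
        (div-*ˡ (integral-^ (d ℕ.∸ 2) (r-integral b x b<p)) (div-* (r-divisible i x b<p) (r-divisible i x b<p))))))
    where
    b = suc m ℕ.+ i
    lemma : ∀ r q → q * (r * r) ≡ r * (r * q)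
    lemma = solve-∀ ℚ-ring

  Φ₁-constant-mod-p² : ∀ x → Φ 1 x ≈ Φ 1 0 [ 2 ]
  Φ₁-constant-mod-p² x = mk≈ (subst (Divisible 2) (sym difference≡Σ) (subst (Divisible 2) (sym split) (div-+ lower upper)))
    where
    open ≡-Reasoning
    lemma : ∀ a b → a - b ≡ a + - 1ℚ * b
    lemma = solve-∀ ℚ-ring
    difference≡Σ : Φ 1 x - Φ 1 0 ≡ Σ< p (change x)
    difference≡Σ = begin
      Φ 1 x - Φ 1 0                                                         ≡⟨ lemma (Φ 1 x) (Φ 1 0) ⟩
      Φ 1 x + - 1ℚ * Φ 1 0                                                  ≡⟨ cong (λ u → Φ 1 x + u) (*-Σ (- 1ℚ) p (λ b → w b 0 * 1ℚ)) ⟨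
      Φ 1 x + Σ< p (λ b → - 1ℚ * (w b 0 * 1ℚ))                              ≡⟨ Σ-+ p (λ b → w b x * 1ℚ) (λ b → - 1ℚ * (w b 0 * 1ℚ)) ⟨
      Σ< p (λ b → w b x * 1ℚ + - 1ℚ * (w b 0 * 1ℚ))                         ≡⟨ Σ-cong p (λ b _ → sym (lemma (w b x * 1ℚ) (w b 0 * 1ℚ))) ⟩
      Σ< p (change x)                                                       ∎
    split : Σ< p (change x) ≡ Σ< (suc m) (change x) + Σ< m (λ i → change x (suc m ℕ.+ i))
    split = trans (cong (λ n → Σ< n (change x)) p≡1+2m) (Σ-split (suc m) m (change x))
    upper : Divisible 2 (Σ< m (λ i → change x (suc m ℕ.+ i)))
    upper = div-Σ m λ i i<m →
      let b<p = subst (suc m ℕ.+ i ℕ.<_) (sym p≡1+2m) (ℕ.+-monoʳ-< (suc m) i<m)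
      in div-+ (subst (Divisible 2) (sym (*-identityʳ _)) (w-divisible i x b<p))
               (div-neg (subst (Divisible 2) (sym (*-identityʳ _)) (w-divisible i 0 b<p)))
    S = Σ< (suc m) (change x)
    -- Adding the sum to its own reversal treats a fixed point b = m - b like every other pair; the
    -- resulting factor 2 is a unit because p is odd.
    double : Σ< (suc m) (λ b → change x b + change x (m ℕ.∸ b)) ≡ ℕ→ℚ 2 * S
    double = trans (Σ-+ (suc m) (change x) (λ b → change x (m ℕ.∸ b)))
      (trans (cong (λ u → S + u) (sym (Σ-reverse m (change x)))) (lemma₂ S))
      where
      lemma₂ : ∀ s → s + s ≡ ℕ→ℚ 2 * s
      lemma₂ = solve-∀ ℚ-ring
    lower : Divisible 2 S
    lower = div-cancel (unit-ι p∤2) (subst (Divisible 2) double (div-Σ (suc m) λ { b (s≤s b≤m) → change-pair b (m ℕ.∸ b) (ℕ.m+[n∸m]≡n b≤m) x }))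

-- Limits of Cauchy sequences in ℤₚ

module Limit (p : ℕ) (pr : Prime p) where
  open Localization p pr

  module _ (q : ℕ → ℚ) (q-integral : ∀ s → Integral (q s)) (q-cauchy : ∀ s → q (suc s) ≈ q s [ suc s ]) where

    -- The index k suffices for precision k: from there on the sequence is already constant modulo p
    -- ^ (k + 1).
    limit-residue : ℕ → ℤ
    limit-residue k = proj₁ (approximate k (q-integral k))

    limit-residue-≈ : ∀ k → q k ≈ ℤ→ℚ (limit-residue k) [ k ]
    limit-residue-≈ k = proj₂ (approximate k (q-integral k))

    limit : ℤₚ p
    limit = record { residue = limit-residue ; coherent = limit-coherent }
      where
      limit-coherent : ∀ k → (+ (p ℕ.^ k)) ℤ.∣ (limit-residue (suc k) ℤ.- limit-residue k)
      limit-coherent k = div⇒ℤ∣ k (limit-residue (suc k) ℤ.- limit-residue k) (subst (Divisible k)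
        (sym (trans (ℤ→ℚ-+ (limit-residue (suc k)) (ℤ.- limit-residue k)) (cong (λ u → ℤ→ℚ (limit-residue (suc k)) + u) (ℤ→ℚ-neg (limit-residue k)))))
        (difference (≈-trans (≈-weaken (ℕ.n≤1+n k) (≈-trans (≈-sym (limit-residue-≈ (suc k))) (q-cauchy k))) (limit-residue-≈ k))))

    q-tail : ∀ k n → q (n ℕ.+ k) ≈ q k [ k ]
    q-tail k zero    = ≈-refl
    q-tail k (suc n) = ≈-trans (≈-weaken (ℕ.≤-trans (ℕ.m≤n+m k n) (ℕ.n≤1+n _)) (q-cauchy (n ℕ.+ k))) (q-tail k n)

    ≈⇒modPow-limit : ∀ {x} k → x ≈ q k [ k ] → x ≡ limit modPow k
    ≈⇒modPow-limit k h with ≈-trans h (limit-residue-≈ k)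
    ... | mk≈ (mkDivisible a ia eq) = a , integral⇒isPIntegral ia , eq

    converges : q ConvergesTo limit
    converges k = k , λ s k≤s → ≈⇒modPow-limit k (subst (λ i → q i ≈ q k [ k ]) (ℕ.m∸n+n≡m k≤s) (q-tail k (s ℕ.∸ k)))

-- Units, limit and congruence for the truncated series

oddPrime : ∀ {p} → Prime p → p ≢ 2 → ∃[ m ] p ≡ suc (m ℕ.+ m)
oddPrime {p} pr p≢2 with p ℕ.% 2 in eq | ℕ.m%n<n p 2
... | 0 | _ with prime⇒irreducible pr (ℕ.m%n≡0⇒n∣m p 2 eq)
...   | inj₂ 2≡p = contradiction (sym 2≡p) p≢2
oddPrime {p} pr p≢2 | 1 | _ = p ℕ./ 2 , trans (ℕ.m≡m%n+[m/n]*n p 2) (trans (cong (ℕ._+ p ℕ./ 2 ℕ.* 2) eq) (cong suc (lemma (p ℕ./ 2))))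
  where
  lemma : ∀ m → m ℕ.* 2 ≡ m ℕ.+ m
  lemma = ℕSolver.solve-∀
oddPrime pr p≢2 | suc (suc _) | s≤s (s≤s ())

theorem1p1 : (d p : ℕ) → 2 ≤ d → Prime p → p ≢ 2 → IsPAdicUnit p (F d p (ε d p)) →
    Σ[ units ∈ AllUnits d p (ε d p) ] Σ[ f ∈ ℤₚ p ] (quotient d p (ε d p) units ConvergesTo f) × (F d p (ε d p) ≡ f modPow 2)
theorem1p1 d p 2≤d pr p≢2 Fₚ-unit = units , f , converges q q-integral q-cauchy , F≡f
  where
  open Localization p pr
  open Weights d p (proj₁ (oddPrime pr p≢2)) 2≤d pr p≢2 (proj₂ (oddPrime pr p≢2))
  open Transfer p pr w
  open Limit p pr

  T₁≡Fₚ : T 1 ≡ F d p z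
  T₁≡Fₚ = trans (T≡F 1) (cong (λ n → F d n z) (ℕ.*-identityʳ p))

  T₁-unit : Unit (T 1)
  T₁-unit = subst Unit (sym T₁≡Fₚ) (isPAdicUnit⇒unit Fₚ-unit)

  T-units : ∀ s → Unit (T s)
  T-units = T-unit w-integral w-lipschitz T₁-unit

  units : AllUnits d p (ε d p)
  units s _ = unit⇒isPAdicUnit (subst Unit (T≡F s) (T-units s))

  q : ℕ → ℚ
  q = quotient d p (ε d p) units

  q*T : ∀ s → q s * T s ≡ T (suc s)
  q*T s = begin
    F′ * 1/ F₀ * T s       ≡⟨ cong (F′ * 1/ F₀ *_) (T≡F s) ⟩
    F′ * 1/ F₀ * F₀        ≡⟨ *-assoc F′ (1/ F₀) F₀ ⟩
    F′ * (1/ F₀ * F₀)      ≡⟨ cong (F′ *_) (*-inverseˡ F₀) ⟩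
    F′ * 1ℚ                ≡⟨ *-identityʳ F′ ⟩
    F′                     ≡⟨ T≡F (suc s) ⟨
    T (suc s)              ∎
    where
    open ≡-Reasoning
    F₀ F′ : ℚ
    F₀ = F d (p ℕ.^ s) z
    F′ = F d (p ℕ.^ suc s) z
    instance
      F₀≢0 : NonZero F₀
      F₀≢0 = F-nonZero d p (ε d p) units s

  q-integral : ∀ s → Integral (q s)
  q-integral s = div⇒integral (div-cancel {0} (T-units s)
    (subst (Divisible 0) (trans (sym (q*T s)) (*-comm (q s) (T s))) (integral⇒div (integral (T-units (suc s))))))

  q-cauchy : ∀ s → q (suc s) ≈ q s [ suc s ]
  q-cauchy = dwork-congruence w-integral w-lipschitz T₁-unit q q*T

  f : ℤₚ p
  f = limit q q-integral q-cauchy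

  F≡f : F d p (ε d p) ≡ f modPow 2
  -- As `T 0` is 1, F_p is `q 0`. The improved congruence leads to `q 1`, and the Dwork congruence
  -- at s = 1 leads on to `q 2`, the term from which the residue of the limit modulo p² is taken.
  F≡f = ≈⇒modPow-limit q q-integral q-cauchy 2 (≈-trans (≈-reflexive (trans (sym T₁≡Fₚ) (trans (sym (q*T 0)) (*-identityʳ (q 0)))))
    (≈-trans (≈-sym (first-quotients-≈-mod-p² w-integral w-lipschitz T₁-unit q q*T Φ₁-constant-mod-p²)) (≈-sym (q-cauchy 1))))
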